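{- Let $p$ be a prime and let $\mathsf{X}$ be a finite connected graph without tails, equipped with the data of a branched $\mathbb{Z}_p$-tower $(\mathsf{X}_n)_{n\ge0}$ arising from the trivial voltage assignment, with all $\mathsf{X}_n$ connected, such that at least one vertex of $\mathsf{X}$ is totally ramified. Suppose $\mathsf{X}$ has a segment decomposition with segments $\mathsf{S}^1,\dots,\mathsf{S}^k$, $\mathsf{S}^i$ being a $t_i$-segment. Let $n_0\ge0$ be such that the number of vertices of $\mathsf{X}_n$ lying over ramified vertices of $\mathsf{X}$ is the same for all $n\ge n_0$, and let $l$ denote this number. Then for all $n\ge n_0$, \[ \kappa(\mathsf{X}_n)=\kappa(\mathsf{X}_{n_0})\,p^{(n-n_0)(l-1)}\prod_{i=1}^kF_{t_i}(\mathsf{S}^i)^{p^n-p^{n_0}}. \]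
   Context: Graphs: a graph has a finite vertex set, directed edges with origin/terminus maps $o,t$ and a fixed-point-free involution $e\mapsto\bar e$ reversing origin and terminus; undirected edges are pairs $\{e,\bar e\}$; multiple edges and loops allowed. $\kappa(\mathsf{Y})$ is the number of spanning trees. Some vertices are ramified (marked), the rest unramified. No tails: no unramified vertex has exactly one neighbour and is joined to it by exactly one edge. Segments: a path is a sequence of distinct vertices with distinct edges joining consecutive ones. An admissible path has two distinct ramified endpoints and only unramified interior vertices. For each pair $\{v,v'\}$ of distinct ramified vertices joined by an admissible path, the admissible paths between them are grouped into classes by the equivalence relation generated by sharing an edge; each class yields a 2-segment (the subgraph of all vertices and edges of its paths). $\mathsf{X}$ has a segment decomposition if (a) no two admissible paths joining different pairs of distinct ramified vertices share an edge, and (b) every edge in no 2-segment lies on a closed path at some ramified vertex $v$ (closed sequence $v=w_0,\dots,w_m=v$, $m\ge1$, distinct edges, $w_1,\dots,w_{m-1}$ distinct, unramified, in no 2-segment); for each $v$ such closed paths are grouped into classes by sharing an edge, each class giving a 1-segment. The segments partition the edges; a $t$-segment has $t$ ramified vertices, which are regarded as its marked vertices. Segmental forests: for a graph $\mathsf{S}$ with $t\in\{1,2\}$ marked vertices, $F_t(\mathsf{S})$ is the number of spanning forests of $\mathsf{S}$ with exactly $t$ components each containing exactly one marked vertex. Towers: $\Gamma\cong\mathbb{Z}_p$, $\Gamma_n=\Gamma/\Gamma^{p^n}$. Given a voltage assignment $\alpha$ ($\alpha(\bar e)=\alpha(e)^{ -1}\in\Gamma$) and closed subgroups $I_v\subseteq\Gamma$,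 $\mathsf{X}_n$ has vertices $\bigsqcup_v\{v\}\times\Gamma_n/\pi_n(I_v)$ and directed edges $(e,g)$, $g\in\Gamma_n$, from $(o(e),gI_{o(e)})$ to $(t(e),g\alpha(e)I_{t(e)})$ (images in $\Gamma_n$), $\overline{(e,g)}=(\bar e,g\alpha(e))$; there are natural projections $\mathsf{X}_n\to\mathsf{X}$. $v$ is ramified if $I_v\ne1$, totally ramified if $I_v=\Gamma$. The trivial voltage assignment has $\alpha(e)=1$ for all $e$. -}

module Defs where

open import Data.Nat using (ℕ; zero; suc; _+_; _*_; _∸_; _^_; _≤_; _⊓_; NonZero)
open import Data.Nat.Properties using (m^n≢0)
open import Data.Nat.DivMod using (_mod_)
open import Data.Nat.Primality using (Prime; prime⇒nonZero)
open import Data.Nat.ListAction using (sum; product)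
open import Data.Bool using (Bool; true; false; if_then_else_)
open import Data.Maybe using (Maybe; just; nothing; is-just)
open import Data.Fin using (Fin; toℕ; remQuot)
open import Data.Fin.Subset using (Subset; _∈_; _⊆_; ⊤)
open import Data.List using (List; []; _∷_; map; length; allFin)
open import Data.List.Membership.Propositional renaming (_∈_ to _∈ₗ_)
open import Data.List.Relation.Unary.All using (All)
open import Data.List.Relation.Unary.Unique.Propositional using (Unique)
open import Data.Product using (Σ; ∃; ∃-syntax; _×_; _,_; proj₁; proj₂)
open import Data.Sum using (_⊎_)
open import Relation.Nullary using (¬_)
open import Relation.Binary.PropositionalEquality using (_≡_; _≢_)
open import Relation.Binary.Construct.Closure.ReflexiveTransitive using (Star)
open import Function.Bundles using (_⇔_)

-- Graphs.  A graph has a vertex type, finitely many undirected edges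
-- Fin nE, each with a chosen orientation (src, tgt).  The directed
-- edges are the pairs (e , b) : Fin nE × Bool, where (e , true) runs
-- src e → tgt e and (e , false) runs tgt e → src e; the involution
-- e ↦ ē is (e , b) ↦ (e , not b).  Loops and multiple edges allowed.

record Graph : Set₁ where
  field
    Vtx : Set
    nE  : ℕ
    src : Fin nE → Vtx
    tgt : Fin nE → Vtx

module _ (G : Graph) where
  open Graph G

  Dart : Set
  Dart = Fin nE × Bool

  o : Dart → Vtx
  o (e , true)  = src e
  o (e , false) = tgt e

  t : Dart → Vtx
  t (e , true)  = tgt e
  t (e , false) = src e

  data Chain : Vtx → List Dart → Vtx → Set where
    nil  : ∀ {u} → Chain u [] u
    cons : ∀ {u w} d ds → o d ≡ u → Chain (t d) ds w → Chain u (d ∷ ds) w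

  edgesOf : List Dart → List (Fin nE)
  edgesOf ds = map proj₁ ds

  interior : List Dart → List Vtx
  interior []            = []
  interior (d ∷ [])      = []
  interior (d ∷ d' ∷ ds) = t d ∷ interior (d' ∷ ds)

  IsPath : Vtx → List Dart → Vtx → Set
  IsPath u ds w = Chain u ds w × Unique (u ∷ map t ds) × Unique (edgesOf ds)

  Conn : Subset nE → Vtx → Vtx → Set
  Conn T u w = ∃[ ds ] (Chain u ds w × All (λ d → proj₁ d ∈ T) ds)

  Connected : Set
  Connected = ∀ u w → ∃[ ds ] Chain u ds w

  HasCycle : Subset nE → Set
  HasCycle T = ∃[ u ] ∃[ d ] ∃[ ds ]
    (Chain u (d ∷ ds) u × Unique (edgesOf (d ∷ ds))
      × Unique (map t (d ∷ ds)) × All (λ d' → proj₁ d' ∈ T) (d ∷ ds))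

  Acyclic : Subset nE → Set
  Acyclic T = ¬ HasCycle T

  IsSpanningTree : Subset nE → Set
  IsSpanningTree T = Acyclic T × (∀ u w → Conn T u w)

  Joins : Fin nE → Vtx → Vtx → Set
  Joins e u w = (src e ≡ u × tgt e ≡ w) ⊎ (src e ≡ w × tgt e ≡ u)

  Adjacent : Vtx → Vtx → Set
  Adjacent u w = ∃[ e ] Joins e u w

CountIs : {n : ℕ} → (Subset n → Set) → ℕ → Set
CountIs {n} P k = Σ (List (Subset n)) λ xs →
  Unique xs × length xs ≡ k × (∀ T → (T ∈ₗ xs) ⇔ P T)

NumSpanningTrees : Graph → ℕ → Set
NumSpanningTrees G k = CountIs (IsSpanningTree G) k

module Marked (G : Graph) (Ram : Graph.Vtx G → Set) where
  open Graph G

  Unram : Vtx → Set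
  Unram v = ¬ Ram v

  NoTails : Set
  NoTails = ∀ v → Unram v → ¬ (∃[ w ] (Adjacent G v w
    × (∀ u → Adjacent G v u → u ≡ w)
    × (∀ e e' → Joins G e v w → Joins G e' v w → e ≡ e')))

  record AdmPath : Set where
    constructor adm
    field
      a b   : Vtx
      ds    : List (Dart G)
      path  : IsPath G a ds b
      ramA  : Ram a
      ramB  : Ram b
      a≢b   : a ≢ b
      inter : All Unram (interior G ds)

  open AdmPath

  SamePair : AdmPath → AdmPath → Set
  SamePair P Q = (a P ≡ a Q × b P ≡ b Q) ⊎ (a P ≡ b Q × b P ≡ a Q)

  ShareEdge : List (Dart G) → List (Dart G) → Set
  ShareEdge ds ds' = ∃[ e ] (e ∈ₗ edgesOf G ds × e ∈ₗ edgesOf G ds')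

  -- one generating step of the equivalence relation on admissible paths
  -- joining the same pair {v,v'}: sharing an edge
  Step2 : AdmPath → AdmPath → Set
  Step2 P Q = SamePair P Q × ShareEdge (ds P) (ds Q)

  Is2Segment : Subset nE → Set
  Is2Segment S = ∃[ P ] (∀ e → (e ∈ S) ⇔
    (∃[ Q ] (Star Step2 P Q × e ∈ₗ edgesOf G (ds Q))))

  EdgeIn2Seg : Fin nE → Set
  EdgeIn2Seg e = ∃[ P ] (e ∈ₗ edgesOf G (ds P))

  VertexIn2Seg : Vtx → Set
  VertexIn2Seg w = ∃[ P ] (w ∈ₗ (a P ∷ map (t G) (ds P)))

  record ClosedPath : Set where
    constructor cp
    field
      v      : Vtx
      ramV   : Ram v
      d      : Dart G
      ds'    : List (Dart G)
      chain  : Chain G v (d ∷ ds') v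
      uniqE  : Unique (edgesOf G (d ∷ ds'))
      uniqV  : Unique (interior G (d ∷ ds'))
      inter  : All (λ w → Unram w × ¬ VertexIn2Seg w) (interior G (d ∷ ds'))

  open ClosedPath

  cpDarts : ClosedPath → List (Dart G)
  cpDarts C = d C ∷ ds' C

  Step1 : ClosedPath → ClosedPath → Set
  Step1 C D = v C ≡ v D × ShareEdge (cpDarts C) (cpDarts D)

  Is1Segment : Subset nE → Set
  Is1Segment S = ∃[ C ] (∀ e → (e ∈ S) ⇔
    (∃[ D ] (Star Step1 C D × e ∈ₗ edgesOf G (cpDarts D))))

  HasSegmentDecomposition : Set
  HasSegmentDecomposition =
    (∀ P Q → ShareEdge (ds P) (ds Q) → SamePair P Q)
    × (∀ e → ¬ EdgeIn2Seg e → ∃[ C ] (e ∈ₗ edgesOf G (cpDarts C)))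

  IsSegment : Subset nE → Set
  IsSegment S = Is2Segment S ⊎ Is1Segment S

  SegVertex : Subset nE → Vtx → Set
  SegVertex S w = ∃[ e ] (e ∈ S × (src e ≡ w ⊎ tgt e ≡ w))

  SegMarked : Subset nE → Vtx → Set
  SegMarked S w = SegVertex S w × Ram w

  IsSegmentalForest : Subset nE → Subset nE → Set
  IsSegmentalForest S T =
    T ⊆ S × Acyclic G T
    × (∀ w → SegVertex S w → ∃[ m ] (SegMarked S m × Conn G T w m))
    × (∀ m m' → SegMarked S m → SegMarked S m' → Conn G T m m' → m ≡ m')

  NumSegmentalForests : Subset nE → ℕ → Set
  NumSegmentalForests S k = CountIs (IsSegmentalForest S) k

-- Base graph and branched Z_p-tower for the trivial voltage assignment.
-- Closed subgroups of Γ ≅ Z_p are {1} (encoded nothing) and p^m Z_p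
-- (encoded just m); just 0 is Γ itself.

baseGraph : (V E : ℕ) → (Fin E → Fin V) → (Fin E → Fin V) → Graph
baseGraph V E s r = record { Vtx = Fin V ; nE = E ; src = s ; tgt = r }

module Tower (p : ℕ) (pp : Prime p) (V E : ℕ) (s r : Fin E → Fin V)
             (I : Fin V → Maybe ℕ) where

  instance
    p≢0 : NonZero p
    p≢0 = prime⇒nonZero pp

  Ram : Fin V → Set
  Ram v = I v ≢ nothing

  -- |Γ_n / π_n(I_v)|
  fibre : Fin V → ℕ → ℕ
  fibre v n with I v
  ... | nothing = p ^ n
  ... | just m  = p ^ (m ⊓ n)

  -- the quotient map Γ_n → Γ_n / π_n(I_v) (Γ_n ≅ ℤ/p^n)
  reduce : (v : Fin V) (n : ℕ) → Fin (p ^ n) → Fin (fibre v n)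
  reduce v n g with I v
  ... | nothing = g
  ... | just m  = _mod_ (toℕ g) (p ^ (m ⊓ n)) {{m^n≢0 p (m ⊓ n)}}

  -- X_n : edges (e , g) from (o e , g I) to (t e , g α(e) I), α(e) = 1
  X : ℕ → Graph
  X n = record
    { Vtx = Σ (Fin V) (λ v → Fin (fibre v n))
    ; nE  = E * p ^ n
    ; src = λ i → let eg = remQuot (p ^ n) i
                  in s (proj₁ eg) , reduce (s (proj₁ eg)) n (proj₂ eg)
    ; tgt = λ i → let eg = remQuot (p ^ n) i
                  in r (proj₁ eg) , reduce (r (proj₁ eg)) n (proj₂ eg)
    }

  ramifiedCount : ℕ → ℕ
  ramifiedCount n =
    sum (map (λ v → if is-just (I v) then fibre v n else 0) (allFin V))

{-# OPTIONS --safe #-}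
module Submission where

-- At an unramified vertex all edges belong to one segment: two admissible
-- (or closed) paths meeting there can be spliced into a third one sharing an
-- edge with both.  Hence X_n is a union of p^n copies of each segment, glued
-- along the l ramified vertices only.  A spanning tree of X_n restricts on
-- each copy either to a segmental forest or, for exactly l - 1 copies of
-- 2-segments, to a spanning tree of the copy; the latter copies, read as edges
-- on the ramified vertices, form a spanning tree of a quotient multigraph.
-- For n ≥ n₀ this multigraph arises from the one for n₀ by replacing every edge
-- by p^(n - n₀) parallel ones, and a spanning tree uses at most one edge of each
-- parallel class, which gives the factor p^((n - n₀)(l - 1)); every additional
-- copy of a segment contributes one factor F.
--
-- Trees are counted by adding edges one at a time, the state being the list
-- of edges chosen so far.  A 1-segment is treated as a 2-segment whose two
-- marked vertices coincide.
open import Defs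
open import Data.Nat using (ℕ; zero; suc; pred; _+_; _*_; _∸_; _^_; _≤_; _<_; _⊓_; NonZero; z≤n; s≤s)
import Data.Nat as ℕ
open import Data.Nat.Properties using (+-identityʳ; *-identityʳ; *-identityˡ; *-distribʳ-+; *-distribˡ-+; *-zeroʳ; *-comm; +-suc; +-mono-≤; +-mono-<-≤; +-cancelˡ-≡; ≤-antisym; ≤-trans; ≤-refl; ≮⇒≥; <-irrefl; <⇒≤; n<1+n; n≤1+n; m^n≢0; ^-monoʳ-<; ^-monoʳ-≤; ^-distribˡ-+-*; ^-*-assoc; ^-zeroˡ; ⊓-monoʳ-≤; m≥n⇒m⊓n≡n; m≤n⇒m⊓n≡m; m∸n+n≡m; m+n∸m≡n; suc-pred)
open import Data.Nat.DivMod using (_%_; _mod_; m%n<n; %-remove-+ˡ)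
open import Data.Nat.Divisibility using (divides; ∣m⇒∣m*n)
open import Data.Nat.Primality using (Prime; prime⇒nonTrivial)
open import Data.Nat.ListAction using (sum; product)
open import Data.Nat.ListAction.Properties using (product-++)
open import Data.Nat.Solver using (module +-*-Solver)
open +-*-Solver using (solve; con; _:=_; _:+_; _:*_)
open import Data.Bool using (true; false; not; if_then_else_)
open import Data.Maybe using (Maybe; just; nothing; is-just)
open import Data.Fin using (Fin; zero; suc; toℕ; fromℕ<; cast; combine; remQuot)
import Data.Fin as Fin
open import Data.Fin.Properties using (toℕ-injective; toℕ-fromℕ<; toℕ<n; toℕ-cast; toℕ-combine; remQuot-combine; combine-remQuot; combine-injective; cast-involutive) renaming (any? to anyFin?)
open import Data.Fin.Subset using (Subset; _∈_; _∉_; _⊆_; _∪_; _-_; ⁅_⁆; inside; outside) renaming (⊥ to ∅)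
open import Data.Fin.Subset.Properties using (_∈?_; Empty-unique; ⊆-antisym; x∈p∪q⁺; x∈p∪q⁻; x∈⁅x⁆; x∈⁅y⁆⇒x≡y; x∈p∧x≢y⇒x∈p-y; p─q⊆p; ∉⊥)
open import Data.Vec as Vec using (_∷_)
open import Data.Vec.Properties using (lookup∘tabulate; []=⇒lookup; lookup⇒[]=)
open import Data.List using (List; []; _∷_; _++_; map; filter; length; lookup; tabulate; concatMap; replicate; upTo; allFin; cartesianProduct)
open import Data.List.Properties using (map-++; map-∘; map-cong; map-tabulate; map-concatMap; concatMap-map; concatMap-cong; ++-assoc; ++-identityʳ; length-++; length-map; length-upTo; length-tabulate; filter-accept; filter-reject)
open import Data.List.Membership.Propositional using (find; lose) renaming (_∈_ to _∈ₗ_)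
open import Data.List.Membership.Propositional.Properties using (∈-++⁺ˡ; ∈-++⁺ʳ; ∈-++⁻; ∈-map⁺; ∈-map⁻; ∈-∃++; ∈-filter⁺; ∈-filter⁻; ∈-concatMap⁺; ∈-concatMap⁻; ∈-cartesianProduct⁺; ∈-upTo⁺; ∈-upTo⁻; ∈-allFin; ∈-lookup)
open import Data.List.Membership.Propositional.Properties.WithK using (unique∧set⇒bag)
open import Data.List.Relation.Unary.Any as Any using (here; there)
open import Data.List.Relation.Unary.Any.Properties using (lookup-index)
open import Data.List.Relation.Unary.All as All using (All; []; _∷_)
import Data.List.Relation.Unary.All.Properties as Allₚ
open import Data.List.Relation.Unary.AllPairs as AllPairs using (AllPairs; []; _∷_)
import Data.List.Relation.Unary.AllPairs.Properties as AllPairsₚ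
open import Data.List.Relation.Unary.Unique.Propositional using (Unique)
import Data.List.Relation.Unary.Unique.Propositional.Properties as Uniqueₚ
open import Data.List.Relation.Binary.BagAndSetEquality using (∼bag⇒↭)
open import Data.List.Relation.Binary.Disjoint.Propositional using (Disjoint)
open import Data.List.Relation.Binary.Pointwise using (Pointwise; []; _∷_)
open import Data.List.Relation.Binary.Permutation.Propositional using (_↭_; prep; swap; ↭-sym; ↭⇒↭ₛ) renaming (refl to ↭-refl; trans to ↭-trans)
open import Data.List.Relation.Binary.Permutation.Propositional.Properties using (∈-resp-↭; shift; ↭-length; ++-comm) renaming (map⁺ to ↭-map⁺)
open import Data.List.Relation.Binary.Permutation.Setoid.Properties using (AllPairs-resp-↭)
open import Data.Product using (∃-syntax; _×_; _,_; proj₁; proj₂)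
import Data.Product as Product
open import Data.Product.Properties using (≡-dec; ,-injective)
open import Data.Sum using (_⊎_; inj₁; inj₂; [_,_]′)
open import Data.Unit using (⊤; tt)
open import Data.Empty using (⊥; ⊥-elim)
open import Relation.Nullary using (¬_; Dec; yes; no)
open import Relation.Nullary.Decidable using (does; dec-true; map′; ¬?; _×-dec_; _⊎-dec_; ¬¬-excluded-middle; decidable-stable)
open import Relation.Binary.Definitions using (DecidableEquality)
open import Relation.Binary.PropositionalEquality using (_≡_; _≢_; refl; sym; trans; cong; cong₂; subst; resp₂; setoid; module ≡-Reasoning)
open import Relation.Binary.Construct.Closure.ReflexiveTransitive using (Star; ε; _◅_; _◅◅_; reverse)
open import Function.Bundles using (_⇔_; mk⇔; Equivalence)
open Equivalence using (to; from)
open import Function using (_∘_; id)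

-- Forests built edge by edge

-- Deletion and contraction along an edge list turns each statement about products of families of
-- subgraphs into an identity of natural numbers, proved by induction on the list; actual subsets of
-- edges enter only in `count-good`. All that passes between a segment and the rest is whether its
-- marked vertices `a` and `b` are connected. Each side can therefore be counted with a virtual pair
-- `(a , b)` that stands for the connection made by the other side. Segmental forests are exactly
-- what this pair completes to spanning trees, whence the factors F. The numbers of spanning trees
-- of the segments enter as well, but only through the weighted sum `Z` over the trees of the
-- quotient multigraph at level n₀. At n = n₀ that sum is the number of spanning trees itself, so it
-- is absorbed into `κn₀` and never evaluated. For each segment there are p^n₀ parallel classes of q
-- = p^(n - n₀) copies. Whether or not a class is used by the tree, q - 1 factors F of it are left
-- over, and (q - 1) * p^n₀ = p^n - p^n₀ is the exponent.

module _ {W : Set} where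

  -- The equivalence relation generated by the pairs. Recursion on the list is possible because a
  -- connection can be shortened until it crosses the first pair at most once, in one of two
  -- directions; in this form it is decidable as soon as equality is.
  Rel : List (W × W) → W → W → Set
  Rel []             u w = u ≡ w
  Rel ((a , b) ∷ es) u w =
    Rel es u w ⊎ (Rel es u a × Rel es b w) ⊎ (Rel es u b × Rel es a w)

  Rel-refl : ∀ es {u} → Rel es u u
  Rel-refl []       = refl
  Rel-refl (_ ∷ es) = inj₁ (Rel-refl es)

  Rel-sym : ∀ es {u w} → Rel es u w → Rel es w u
  Rel-sym []       h                      = sym h
  Rel-sym (_ ∷ es) (inj₁ h)               = inj₁ (Rel-sym es h)
  Rel-sym (_ ∷ es) (inj₂ (inj₁ (h , k))) = inj₂ (inj₂ (Rel-sym es k , Rel-sym es h))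
  Rel-sym (_ ∷ es) (inj₂ (inj₂ (h , k))) = inj₂ (inj₁ (Rel-sym es k , Rel-sym es h))

  Rel-trans : ∀ es {u v w} → Rel es u v → Rel es v w → Rel es u w
  Rel-trans [] h k = trans h k
  Rel-trans (_ ∷ es) = go
    where
    _∙_ : ∀ {u v w} → Rel es u v → Rel es v w → Rel es u w
    _∙_ = Rel-trans es
    go : ∀ {u v w} → Rel (_ ∷ es) u v → Rel (_ ∷ es) v w → Rel (_ ∷ es) u w
    go (inj₁ h)              (inj₁ k)              = inj₁ (h ∙ k)
    go (inj₁ h)              (inj₂ (inj₁ (k , l))) = inj₂ (inj₁ (h ∙ k , l))
    go (inj₁ h)              (inj₂ (inj₂ (k , l))) = inj₂ (inj₂ (h ∙ k , l))
    go (inj₂ (inj₁ (g , h))) (inj₁ k)              = inj₂ (inj₁ (g , h ∙ k))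
    go (inj₂ (inj₂ (g , h))) (inj₁ k)              = inj₂ (inj₂ (g , h ∙ k))
    go (inj₂ (inj₁ (g , h))) (inj₂ (inj₁ (k , l))) = inj₂ (inj₁ (g , l))
    go (inj₂ (inj₁ (g , h))) (inj₂ (inj₂ (k , l))) = inj₁ (g ∙ l)
    go (inj₂ (inj₂ (g , h))) (inj₂ (inj₁ (k , l))) = inj₁ (g ∙ l)
    go (inj₂ (inj₂ (g , h))) (inj₂ (inj₂ (k , l))) = inj₂ (inj₂ (g , l))

  Rel-edge : ∀ {es a b} → (a , b) ∈ₗ es → Rel es a b
  Rel-edge {_ ∷ es} (here refl) = inj₂ (inj₁ (Rel-refl es , Rel-refl es))
  Rel-edge {_ ∷ es} (there e∈)  = inj₁ (Rel-edge e∈)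

  Rel-least : ∀ es {_~_ : W → W → Set} →
    (∀ {u} → u ~ u) → (∀ {u w} → u ~ w → w ~ u) →
    (∀ {u v w} → u ~ v → v ~ w → u ~ w) →
    (∀ {a b} → (a , b) ∈ₗ es → a ~ b) → ∀ {u w} → Rel es u w → u ~ w
  Rel-least []       r s t h refl = r
  Rel-least (_ ∷ es) {_~_} r s t h = go
    where
    rec : ∀ {u w} → Rel es u w → u ~ w
    rec = Rel-least es r s t (h ∘ there)
    go : ∀ {u w} → Rel (_ ∷ es) u w → u ~ w
    go (inj₁ k)              = rec k
    go (inj₂ (inj₁ (k , l))) = t (rec k) (t (h (here refl)) (rec l))
    go (inj₂ (inj₂ (k , l))) = t (rec k) (t (s (h (here refl))) (rec l))

  Rel-mono : ∀ es {es'} → (∀ {a b} → (a , b) ∈ₗ es → Rel es' a b) →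
    ∀ {u w} → Rel es u w → Rel es' u w
  Rel-mono es {es'} = Rel-least es (Rel-refl es') (Rel-sym es') (Rel-trans es')

  Rel-⊆ : ∀ es {es'} → (∀ {e} → e ∈ₗ es → e ∈ₗ es') → ∀ {u w} → Rel es u w → Rel es' u w
  Rel-⊆ es h = Rel-mono es (Rel-edge ∘ h)

  -- The exchange property of graphs: a connection that needs `(a , b)` runs through it, and its two
  -- remaining parts, joined by `(u , w)`, connect `a` to `b`.
  Rel-exchange : ∀ es {a b u w} → Rel ((a , b) ∷ es) u w → ¬ Rel es u w → Rel ((u , w) ∷ es) a b
  Rel-exchange es (inj₁ h)              ¬h = ⊥-elim (¬h h)
  Rel-exchange es (inj₂ (inj₁ (h , k))) _  = inj₂ (inj₁ (Rel-sym es h , Rel-sym es k))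
  Rel-exchange es (inj₂ (inj₂ (h , k))) _  = inj₂ (inj₂ (k , h))

  Acyc : List (W × W) → Set
  Acyc []             = ⊤
  Acyc ((a , b) ∷ es) = ¬ Rel es a b × Acyc es

  -- `Acyc` tests each pair against the later ones, so independence of the order needs proof. In a
  -- swap, a cycle closed by `(c , d)` over `(a , b)` becomes, by exchange, one closed by `(a , b)`
  -- over `(c , d)`.
  Acyc-↭ : ∀ {es es'} → es ↭ es' → Acyc es → Acyc es'
  Acyc-↭ ↭-refl      h       = h
  Acyc-↭ (prep _ p)  (n , h) = n ∘ Rel-⊆ _ (∈-resp-↭ (↭-sym p)) , Acyc-↭ p h
  Acyc-↭ (swap {xs} {ys} (a , b) (c , d) p) (n , m , h) =
    (λ k → n (Rel-exchange xs (inner k) m)) ,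
    (λ k → n (inj₁ (Rel-⊆ ys (∈-resp-↭ (↭-sym p)) k))) , Acyc-↭ p h
    where
    inner : Rel ((a , b) ∷ ys) c d → Rel ((a , b) ∷ xs) c d
    inner = Rel-⊆ ((a , b) ∷ ys) (∈-resp-↭ (↭-sym (prep _ p)))
  Acyc-↭ (↭-trans p q) h = Acyc-↭ q (Acyc-↭ p h)

  _Within_ : W × W → List W → Set
  (u , w) Within D = u ∈ₗ D × w ∈ₗ D

  Total : List W → List (W × W) → Set
  Total D es = All (λ u → All (λ w → Rel es u w) D) D

  total⇒rel : ∀ {D es u w} → Total D es → u ∈ₗ D → w ∈ₗ D → Rel es u w
  total⇒rel h u∈ w∈ = All.lookup (All.lookup h u∈) w∈

  rel⇒total : ∀ {D es} → (∀ {u w} → u ∈ₗ D → w ∈ₗ D → Rel es u w) → Total D es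
  rel⇒total h = All.tabulate λ u∈ → All.tabulate λ w∈ → h u∈ w∈

  -- A state influences the later count only through the relation it induces on `D`; this is the
  -- congruence under which states are replaced, even when they mention vertices outside `D`.
  AgreeOn : List W → List (W × W) → List (W × W) → Set
  AgreeOn D es es' = ∀ {u w} → u ∈ₗ D → w ∈ₗ D → Rel es u w ⇔ Rel es' u w

  agree-∷ : ∀ {D es es' e} → e Within D → AgreeOn D es es' → AgreeOn D (e ∷ es) (e ∷ es')
  agree-∷ (a∈ , b∈) h u∈ w∈ = mk⇔
    (λ { (inj₁ k) → inj₁ (to (h u∈ w∈) k)
       ; (inj₂ (inj₁ (k , l))) → inj₂ (inj₁ (to (h u∈ a∈) k , to (h b∈ w∈) l))
       ; (inj₂ (inj₂ (k , l))) → inj₂ (inj₂ (to (h u∈ b∈) k , to (h a∈ w∈) l)) })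
    (λ { (inj₁ k) → inj₁ (from (h u∈ w∈) k)
       ; (inj₂ (inj₁ (k , l))) → inj₂ (inj₁ (from (h u∈ a∈) k , from (h b∈ w∈) l))
       ; (inj₂ (inj₂ (k , l))) → inj₂ (inj₂ (from (h u∈ b∈) k , from (h a∈ w∈) l)) })

  agree-↭ : ∀ {D es es'} → es ↭ es' → AgreeOn D es es'
  agree-↭ p _ _ = mk⇔ (Rel-⊆ _ (∈-resp-↭ p)) (Rel-⊆ _ (∈-resp-↭ (↭-sym p)))

  agree-trans : ∀ {D es es' es''} → AgreeOn D es es' → AgreeOn D es' es'' → AgreeOn D es es''
  agree-trans h k u∈ w∈ = mk⇔ (to (k u∈ w∈) ∘ to (h u∈ w∈)) (from (h u∈ w∈) ∘ from (k u∈ w∈))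

  agree-related : ∀ {D es a b} → Rel es a b → AgreeOn D ((a , b) ∷ es) es
  agree-related {es = es} h _ _ = mk⇔
    (Rel-mono (_ ∷ es) λ { (here refl) → h ; (there e∈) → Rel-edge e∈ }) inj₁

-- Counting by deletion and contraction, and gluing along two vertices.

indicator : {A : Set} → Dec A → ℕ
indicator (yes _) = 1
indicator (no _)  = 0

indicator-cong : {A B : Set} (d : Dec A) (d' : Dec B) → A ⇔ B → indicator d ≡ indicator d'
indicator-cong (yes _) (yes _) _ = refl
indicator-cong (yes a) (no ¬b) h = ⊥-elim (¬b (to h a))
indicator-cong (no ¬a) (yes b) h = ⊥-elim (¬a (from h b))
indicator-cong (no _)  (no _)  _ = refl

indicator-no : {A : Set} (d : Dec A) → ¬ A → indicator d ≡ 0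
indicator-no (yes a) ¬a = ⊥-elim (¬a a)
indicator-no (no _)  _  = refl

indicator-× : {A B C : Set} (d : Dec A) (d' : Dec B) (d'' : Dec C) →
  A ⇔ (B × C) → indicator d ≡ indicator d' * indicator d''
indicator-× d (yes b) (yes c) h = indicator-cong d (yes tt) (mk⇔ _ λ _ → from h (b , c))
indicator-× d (yes b) (no ¬c) h = indicator-no d (¬c ∘ proj₂ ∘ to h)
indicator-× d (no ¬b) d''     h = indicator-no d (¬b ∘ proj₁ ∘ to h)

unless : {A : Set} → Dec A → ℕ → ℕ
unless (yes _) _ = 0
unless (no _)  k = k

unless-yes : {A : Set} (d : Dec A) {k : ℕ} → A → unless d k ≡ 0
unless-yes (yes _) _ = refl
unless-yes (no ¬a) a = ⊥-elim (¬a a)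

unless-no : {A : Set} (d : Dec A) {k : ℕ} → ¬ A → unless d k ≡ k
unless-no (yes a) ¬a = ⊥-elim (¬a a)
unless-no (no _)  _  = refl

unless-cong : {A B : Set} (d : Dec A) (d' : Dec B) {k k' : ℕ} → A ⇔ B → (¬ A → k ≡ k') →
  unless d k ≡ unless d' k'
unless-cong (yes a) d'  h _ = sym (unless-yes d' (to h a))
unless-cong (no ¬a) d'  h e = trans (e ¬a) (sym (unless-no d' (¬a ∘ from h)))

module Count {W : Set} (_≟_ : DecidableEquality W) where

  open import Data.List.Membership.DecPropositional _≟_ using () renaming (_∈?_ to _∈ᵂ?_)

  rel? : ∀ es (u w : W) → Dec (Rel es u w)
  rel? []             u w = u ≟ w
  rel? ((a , b) ∷ es) u w =
    rel? es u w ⊎-dec (rel? es u a ×-dec rel? es b w) ⊎-dec (rel? es u b ×-dec rel? es a w)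

  total? : ∀ D es → Dec (Total D es)
  total? D es = All.all? (λ u → All.all? (λ w → rel? es u w) D) D

  -- N D st es is the number of sublists of es that, added to the pairs in
  -- st, close no cycle and relate all vertices of D.
  N : List W → List (W × W) → List (W × W) → ℕ
  N D st []             = indicator (total? D st)
  N D st ((a , b) ∷ es) = N D st es + unless (rel? st a b) (N D ((a , b) ∷ st) es)

  N-cong : ∀ {D D'} → (∀ {x} → x ∈ₗ D ⇔ x ∈ₗ D') → ∀ es {st st'} → All (_Within D) es →
    AgreeOn D st st' → N D st es ≡ N D' st' es
  N-cong {D} {D'} hD [] {st} {st'} _ h = indicator-cong (total? D st) (total? D' st')
    (mk⇔ (λ t → rel⇒total λ u∈ w∈ → to (h (from hD u∈) (from hD w∈)) (total⇒rel t (from hD u∈) (from hD w∈)))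
         (λ t → rel⇒total λ u∈ w∈ → from (h u∈ w∈) (total⇒rel t (to hD u∈) (to hD w∈))))
  N-cong hD (e ∷ es) {st} {st'} (e∈ ∷ es∈) h = cong₂ _+_ (N-cong hD es es∈ h)
    (unless-cong (rel? st _ _) (rel? st' _ _) (h (proj₁ e∈) (proj₂ e∈))
      λ _ → N-cong hD es es∈ (agree-∷ e∈ h))

  N-agree : ∀ {D} es {st st'} → All (_Within D) es → AgreeOn D st st' → N D st es ≡ N D st' es
  N-agree = N-cong (mk⇔ id id)

  -- Collapsing the B-side onto {a, b} turns the relation generated by τ into
  -- an equivalence relation containing σ.
  glue : ∀ {a b A B σ τ ρ} → (∀ {x} → x ∈ₗ A → x ∈ₗ B → x ≡ a ⊎ x ≡ b) →
    (∀ {x y} → (x , y) ∈ₗ σ →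
      ((x , y) Within A × Rel τ x y) ⊎ ((x , y) Within B × Rel ρ x y)) →
    (Rel ρ a b → Rel τ a b) →
    ∀ {u w} → u ∈ₗ A → w ∈ₗ A → Rel σ u w → Rel τ u w
  glue {a} {b} {A} {B} {σ} {τ} {ρ} A∩B cover ab {u} {w} u∈ w∈ h =
    subst (λ z → Rel τ z w) (proj-A u∈) (subst (Rel τ (proj u)) (proj-A w∈)
      (Rel-least σ {λ x y → Rel τ (proj x) (proj y)}
        (Rel-refl τ) (Rel-sym τ) (Rel-trans τ) gen h))
    where
    proj : W → W
    -- Outside `A`, vertices related to `b` under `ρ` go to `b` and all others to `a`, even those
    -- that reach neither. If `a` itself is related to `b`, it stays fixed while its class goes to
    -- `b`; the hypothesis `ab` repairs this.
    proj x with x ∈ᵂ? A | rel? ρ x b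
    ... | yes _ | _     = x
    ... | no _  | yes _ = b
    ... | no _  | no _  = a
    proj-A : ∀ {x} → x ∈ₗ A → proj x ≡ x
    proj-A {x} x∈ with x ∈ᵂ? A
    ... | yes _ = refl
    ... | no ¬x = ⊥-elim (¬x x∈)
    proj-b : ∀ {x} → x ∈ₗ B → Rel ρ x b → Rel τ (proj x) b
    proj-b {x} x∈ k with x ∈ᵂ? A | rel? ρ x b
    ... | no _   | yes _ = Rel-refl τ
    ... | no _   | no ¬k = ⊥-elim (¬k k)
    ... | yes x∈A | _ with A∩B x∈A x∈
    ...   | inj₁ refl = ab k
    ...   | inj₂ refl = Rel-refl τ
    proj-a : ∀ {x} → x ∈ₗ B → ¬ Rel ρ x b → Rel τ (proj x) a
    proj-a {x} x∈ ¬k with x ∈ᵂ? A | rel? ρ x b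
    ... | no _   | yes k = ⊥-elim (¬k k)
    ... | no _   | no _  = Rel-refl τ
    ... | yes x∈A | _ with A∩B x∈A x∈
    ...   | inj₁ refl = Rel-refl τ
    ...   | inj₂ refl = ⊥-elim (¬k (Rel-refl ρ))
    gen : ∀ {x y} → (x , y) ∈ₗ σ → Rel τ (proj x) (proj y)
    gen {x} {y} e∈ with cover e∈
    ... | inj₁ ((x∈ , y∈) , k) rewrite proj-A x∈ | proj-A y∈ = k
    ... | inj₂ ((x∈ , y∈) , k) = split (rel? ρ x b)
      where
      split : Dec (Rel ρ x b) → Rel τ (proj x) (proj y)
      split (yes l) = Rel-trans τ (proj-b x∈ l)
        (Rel-sym τ (proj-b y∈ (Rel-trans ρ (Rel-sym ρ k) l)))
      split (no ¬l) = Rel-trans τ (proj-a x∈ ¬l)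
        (Rel-sym τ (proj-a y∈ λ l → ¬l (Rel-trans ρ k l)))

  module Glue (a b : W) (A B D : List W)
    (a∈A : a ∈ₗ A) (b∈A : b ∈ₗ A) (a∈B : a ∈ₗ B) (b∈B : b ∈ₗ B)
    (A∩B : ∀ {x} → x ∈ₗ A → x ∈ₗ B → x ≡ a ⊎ x ≡ b)
    (D⇔ : ∀ {x} → x ∈ₗ D ⇔ (x ∈ₗ A ⊎ x ∈ₗ B))
    where

    module _ {st ρ} (stA : All (_Within A) st) (ρB : All (_Within B) ρ) where

      -- Seen from `A`, everything chosen in `B` amounts to at most a link between `a` and `b`, so
      -- `τ` has to contain `st` and to supply that link whenever `ρ` does.
      Rel-A : ∀ {τ} → (∀ {e} → e ∈ₗ st → e ∈ₗ τ) → (Rel ρ a b → Rel τ a b) →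
        ∀ {u w} → u ∈ₗ A → w ∈ₗ A → Rel (st ++ ρ) u w → Rel τ u w
      Rel-A h = glue A∩B λ e∈ → [ (λ k → inj₁ (All.lookup stA k , Rel-edge (h k)))
        , (λ k → inj₂ (All.lookup ρB k , Rel-edge k)) ]′ (∈-++⁻ st e∈)

      Rel-B : ∀ {τ} → (∀ {e} → e ∈ₗ ρ → e ∈ₗ τ) → (Rel st a b → Rel τ a b) →
        ∀ {u w} → u ∈ₗ B → w ∈ₗ B → Rel (st ++ ρ) u w → Rel τ u w
      Rel-B h = glue (λ x∈ y∈ → A∩B y∈ x∈) λ e∈ → [ (λ k → inj₂ (All.lookup stA k , Rel-edge k))
        , (λ k → inj₁ (All.lookup ρB k , Rel-edge (h k))) ]′ (∈-++⁻ st e∈)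

      total-++ : ∀ {ρ'} → AgreeOn B (st ++ ρ) ρ' →
        Total D (st ++ ρ) ⇔ (Total A ((a , b) ∷ st) × Total B ρ')
      total-++ {ρ'} agree = mk⇔
        (λ t → rel⇒total (λ u∈ w∈ → Rel-A there (λ _ → Rel-edge (here refl)) u∈ w∈
                  (total⇒rel t (from D⇔ (inj₁ u∈)) (from D⇔ (inj₁ w∈))))
             , rel⇒total (λ u∈ w∈ → to (agree u∈ w∈)
                  (total⇒rel t (from D⇔ (inj₂ u∈)) (from D⇔ (inj₂ w∈)))))
        (λ (tA , tB) → rel⇒total λ u∈ w∈ →
          Rel-trans σ (toa tA tB u∈) (Rel-sym σ (toa tA tB w∈)))
        where
        σ = st ++ ρ
        toa : Total A ((a , b) ∷ st) → Total B ρ' → ∀ {u} → u ∈ₗ D → Rel σ u a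
        toa tA tB {u} u∈ with to D⇔ u∈
        ... | inj₂ u∈B = from (agree u∈B a∈B) (total⇒rel tB u∈B a∈B)
        ... | inj₁ u∈A = Rel-mono ((a , b) ∷ st)
          (λ { (here refl) → from (agree a∈B b∈B) (total⇒rel tB a∈B b∈B)
             ; (there e∈) → Rel-edge (∈-++⁺ˡ e∈) })
          (total⇒rel tA u∈A a∈A)

    -- All pairs on the `A` side are decided, so `A` contributes a constant 0 or 1: whether `st`
    -- with a link from `a` to `b` connects it. The link may be assumed, because the other factor
    -- demands that `a` and `b` end up connected. The list `ρ'` is the state as `B` sees it: callers
    -- take `(a , b) ∷ ρ` or `ρ`, according to whether `a` and `b` are already connected.
    N-outer : ∀ {st} → All (_Within A) st → ∀ rest {ρ ρ'} → All (_Within B) rest →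
      All (_Within B) ρ → AgreeOn B (st ++ ρ) ρ' →
      N D (st ++ ρ) rest ≡ N A ((a , b) ∷ st) [] * N B ρ' rest
    N-outer {st} stA [] {ρ} {ρ'} _ ρB agree =
      indicator-× (total? D (st ++ ρ)) (total? A _) (total? B ρ') (total-++ stA ρB agree)
    N-outer {st} stA (e ∷ rest) {ρ} {ρ'} (e∈ ∷ rest∈) ρB agree = begin
      N D (st ++ ρ) rest + unless d (N D (e ∷ st ++ ρ) rest)
        ≡⟨ cong₂ _+_ (N-outer stA rest rest∈ ρB agree)
             (unless-cong d d' (agree (proj₁ e∈) (proj₂ e∈)) λ _ → begin
               N D (e ∷ st ++ ρ) rest
                 ≡⟨ N-agree rest (All.map (λ (u∈ , w∈) → from D⇔ (inj₂ u∈) , from D⇔ (inj₂ w∈)) rest∈) (agree-↭ move) ⟩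
               N D (st ++ e ∷ ρ) rest
                 ≡⟨ N-outer stA rest rest∈ (e∈ ∷ ρB)
                      (agree-trans (agree-↭ (↭-sym move)) (agree-∷ e∈ agree)) ⟩
               N A _ [] * N B (e ∷ ρ') rest ∎) ⟩
      F * N B ρ' rest + unless d' (F * N B (e ∷ ρ') rest)
        ≡⟨ cong (F * N B ρ' rest +_) (unless-* d') ⟩
      F * N B ρ' rest + F * unless d' (N B (e ∷ ρ') rest)
        ≡⟨ sym (*-distribˡ-+ F _ _) ⟩
      F * (N B ρ' rest + unless d' (N B (e ∷ ρ') rest)) ∎
      where
      open ≡-Reasoning
      F = N A ((a , b) ∷ st) []
      d = rel? (st ++ ρ) (proj₁ e) (proj₂ e)
      d' = rel? ρ' (proj₁ e) (proj₂ e)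
      move : e ∷ st ++ ρ ↭ st ++ e ∷ ρ
      move = ↭-sym (shift e st ρ)
      unless-* : {X : Set} (x : Dec X) {k : ℕ} → unless x (F * k) ≡ F * unless x k
      unless-* (yes _) = sym (*-zeroʳ F)
      unless-* (no _)  = refl

    -- Once `a` and `b` are connected, by whichever side, a pair closes a cycle in the whole exactly
    -- when it closes one on its own side with the link added, so the choices on the two sides are
    -- independent.
    N-related : ∀ es {st ρ rest} → All (_Within A) es → All (_Within B) rest →
      All (_Within A) st → All (_Within B) ρ → Rel (st ++ ρ) a b →
      N D (st ++ ρ) (es ++ rest) ≡ N A ((a , b) ∷ st) es * N B ((a , b) ∷ ρ) rest
    N-related [] {st} {ρ} {rest} _ rest∈ stA ρB h = N-outer stA rest rest∈ ρB λ u∈ w∈ → mk⇔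
      (Rel-B stA ρB there (λ _ → Rel-edge (here refl)) u∈ w∈)
      (Rel-mono ((a , b) ∷ ρ) λ { (here refl) → h ; (there e∈) → Rel-edge (∈-++⁺ʳ st e∈) })
    N-related (e ∷ es) {st} {ρ} {rest} (e∈ ∷ es∈) rest∈ stA ρB h = begin
      N D (st ++ ρ) (es ++ rest) + unless d (N D (e ∷ st ++ ρ) (es ++ rest))
        ≡⟨ cong₂ _+_ (N-related es es∈ rest∈ stA ρB h)
          (unless-cong d d' (mk⇔ (Rel-A stA ρB there (λ _ → Rel-edge (here refl)) (proj₁ e∈) (proj₂ e∈))
              (Rel-mono ((a , b) ∷ st) λ { (here refl) → h ; (there k) → Rel-edge (∈-++⁺ˡ k) }))
            λ _ → trans (N-related es es∈ rest∈ (e∈ ∷ stA) ρB (inj₁ h))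
              (cong (_* M) (N-agree es es∈ (agree-↭ (swap _ _ ↭-refl))))) ⟩
      N A ((a , b) ∷ st) es * M + unless d' (N A (e ∷ (a , b) ∷ st) es * M)
        ≡⟨ cong (N A ((a , b) ∷ st) es * M +_) (unless-* d') ⟩
      N A ((a , b) ∷ st) es * M + unless d' (N A (e ∷ (a , b) ∷ st) es) * M
        ≡⟨ sym (*-distribʳ-+ M (N A ((a , b) ∷ st) es) _) ⟩
      N A ((a , b) ∷ st) (e ∷ es) * M ∎
      where
      open ≡-Reasoning
      M = N B ((a , b) ∷ ρ) rest
      d = rel? (st ++ ρ) (proj₁ e) (proj₂ e)
      d' = rel? ((a , b) ∷ st) (proj₁ e) (proj₂ e)
      unless-* : {X : Set} (x : Dec X) {k : ℕ} → unless x (k * M) ≡ unless x k * M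
      unless-* (yes _) = refl
      unless-* (no _)  = refl

    -- A tree connects `a` to `b` through exactly one of the two sides. In the first summand `B`
    -- makes the connection and `A` is counted with a virtual one; in the second the roles are
    -- exchanged.
    N-unrelated : ∀ es {st ρ rest} → All (_Within A) es → All (_Within B) rest →
      All (_Within A) st → All (_Within B) ρ → ¬ Rel st a b → ¬ Rel ρ a b →
      N D (st ++ ρ) (es ++ rest) ≡
        N A ((a , b) ∷ st) es * N B ρ rest + N A st es * N B ((a , b) ∷ ρ) rest
    N-unrelated [] {st} {ρ} {rest} _ rest∈ stA ρB ¬st ¬ρ = begin
      N D (st ++ ρ) rest
        ≡⟨ N-outer stA rest rest∈ ρB (λ u∈ w∈ → mk⇔ (Rel-B stA ρB id (⊥-elim ∘ ¬st) u∈ w∈)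
             (Rel-⊆ ρ (∈-++⁺ʳ st))) ⟩
      F * N B ρ rest
        ≡⟨ sym (+-identityʳ _) ⟩
      F * N B ρ rest + 0
        -- No pair of `A` is left and `st` does not connect `a` to `b`, so the case where `A` makes
        -- the connection counts 0.
        ≡⟨ cong (λ k → F * N B ρ rest + k * N B ((a , b) ∷ ρ) rest)
             (sym (indicator-no (total? A st) λ t → ¬st (total⇒rel t a∈A b∈A))) ⟩
      F * N B ρ rest + N A st [] * N B ((a , b) ∷ ρ) rest ∎
      where
      open ≡-Reasoning
      F = N A ((a , b) ∷ st) []
    N-unrelated (e@(u , w) ∷ es) {st} {ρ} {rest} (e∈ ∷ es∈) rest∈ stA ρB ¬st ¬ρ
      with rel? (st ++ ρ) u w | rel? st u w | rel? ((a , b) ∷ st) u w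
    ... | yes k | no ¬k | _ = ⊥-elim (¬k (Rel-A stA ρB id (⊥-elim ∘ ¬ρ) (proj₁ e∈) (proj₂ e∈) k))
    ... | no ¬k | yes k | _ = ⊥-elim (¬k (Rel-⊆ st ∈-++⁺ˡ k))
    ... | _ | yes k | no ¬k = ⊥-elim (¬k (inj₁ k))
    ... | yes _ | yes _ | yes _ = begin
      N D (st ++ ρ) (es ++ rest) + 0
        ≡⟨ +-identityʳ _ ⟩
      N D (st ++ ρ) (es ++ rest)
        ≡⟨ N-unrelated es es∈ rest∈ stA ρB ¬st ¬ρ ⟩
      N A ((a , b) ∷ st) es * N B ρ rest + N A st es * N B ((a , b) ∷ ρ) rest
        ≡⟨ sym (cong₂ (λ x y → x * N B ρ rest + y * N B ((a , b) ∷ ρ) rest)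
             (+-identityʳ (N A ((a , b) ∷ st) es)) (+-identityʳ (N A st es))) ⟩
      (N A ((a , b) ∷ st) es + 0) * N B ρ rest + (N A st es + 0) * N B ((a , b) ∷ ρ) rest ∎
      where open ≡-Reasoning
    -- By exchange, taking `e` connects `a` to `b` inside `A`. The state becomes related, and the
    -- trees with `e` contribute to the second summand only.
    ... | no _ | no ¬k | yes k = begin
      N D (st ++ ρ) (es ++ rest) + N D (e ∷ st ++ ρ) (es ++ rest)
        ≡⟨ cong₂ _+_ (N-unrelated es es∈ rest∈ stA ρB ¬st ¬ρ)
             (trans (N-related es es∈ rest∈ (e∈ ∷ stA) ρB (Rel-⊆ (e ∷ st) ∈-++⁺ˡ ab))
               (cong (_* M') (N-agree es es∈ (agree-related ab)))) ⟩
      (F * M + K * M') + K' * M'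
        ≡⟨ solve 5 (λ F K K' M M' → (F :* M :+ K :* M') :+ K' :* M' := (F :+ con 0) :* M :+ (K :+ K') :* M')
             refl F K K' M M' ⟩
      (F + 0) * M + (K + K') * M' ∎
      where
      open ≡-Reasoning
      M = N B ρ rest
      M' = N B ((a , b) ∷ ρ) rest
      F = N A ((a , b) ∷ st) es
      K = N A st es
      K' = N A (e ∷ st) es
      ab : Rel (e ∷ st) a b
      ab = Rel-exchange st k ¬k
    -- Even with `e` taken, `a` and `b` stay unconnected, so the trees with `e` contribute to both
    -- summands.
    ... | no _ | no ¬k | no ¬k' = begin
      N D (st ++ ρ) (es ++ rest) + N D (e ∷ st ++ ρ) (es ++ rest)
        ≡⟨ cong₂ _+_ (N-unrelated es es∈ rest∈ stA ρB ¬st ¬ρ)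
             (trans (N-unrelated es es∈ rest∈ (e∈ ∷ stA) ρB (λ h → ¬k' (Rel-exchange st h ¬st)) ¬ρ)
               (cong (λ x → x * M + K' * M') (N-agree es es∈ (agree-↭ (swap _ _ ↭-refl))))) ⟩
      (F * M + K * M') + (F' * M + K' * M')
        ≡⟨ solve 6 (λ F F' K K' M M' → (F :* M :+ K :* M') :+ (F' :* M :+ K' :* M') := (F :+ F') :* M :+ (K :+ K') :* M')
             refl F F' K K' M M' ⟩
      (F + F') * M + (K + K') * M' ∎
      where
      open ≡-Reasoning
      M = N B ρ rest
      M' = N B ((a , b) ∷ ρ) rest
      F = N A ((a , b) ∷ st) es
      F' = N A (e ∷ (a , b) ∷ st) es
      K = N A st es
      K' = N A (e ∷ st) es

    -- A block acts as one weighted edge from `a` to `b`, deleted with the first weight and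
    -- contracted with the second. If `a` and `b` coincide, `Rel ρ a b` holds by reflexivity and the
    -- edge is a loop that is never taken; this covers 1-segments.
    N-block : ∀ {es ρ rest} → All (_Within A) es → All (_Within B) rest → All (_Within B) ρ →
      N D ρ (es ++ rest) ≡ N A ((a , b) ∷ []) es * N B ρ rest
        + unless (rel? ρ a b) (N A [] es * N B ((a , b) ∷ ρ) rest)
    N-block {es} {ρ} {rest} es∈ rest∈ ρB with rel? ρ a b
    ... | yes h = trans (N-related es es∈ rest∈ [] ρB h)
      (trans (cong (N A _ es *_) (N-agree rest rest∈ (agree-related h))) (sym (+-identityʳ _)))
    ... | no ¬h = N-unrelated es es∈ rest∈ [] ρB (λ { refl → ¬h (Rel-refl ρ) }) ¬h

AllPairs-map-∈ : {A : Set} {P Q : A → A → Set} {xs : List A} →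
  (∀ {u w} → u ∈ₗ xs → w ∈ₗ xs → P u w → Q u w) → AllPairs P xs → AllPairs Q xs
AllPairs-map-∈ h []       = []
AllPairs-map-∈ h (p ∷ ps) = All.tabulate (λ w∈ → h (here refl) (there w∈) (All.lookup p w∈))
  ∷ AllPairs-map-∈ (λ u∈ w∈ → h (there u∈) (there w∈)) ps

-- Transport of counts along injective vertex maps.

map² : {W W' : Set} → (W → W') → W × W → W' × W'
map² φ = Product.map φ φ

module _ {W W' : Set} (φ : W → W') (φ-injective : ∀ {u w} → φ u ≡ φ w → u ≡ w) where

  Rel-map : ∀ es {u w} → Rel (map (map² φ) es) (φ u) (φ w) ⇔ Rel es u w
  Rel-map []       = mk⇔ φ-injective (cong φ)
  Rel-map ((a , b) ∷ es) = mk⇔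
    (λ { (inj₁ h) → inj₁ (to r h)
       ; (inj₂ (inj₁ (h , k))) → inj₂ (inj₁ (to r h , to r k))
       ; (inj₂ (inj₂ (h , k))) → inj₂ (inj₂ (to r h , to r k)) })
    (λ { (inj₁ h) → inj₁ (from r h)
       ; (inj₂ (inj₁ (h , k))) → inj₂ (inj₁ (from r h , from r k))
       ; (inj₂ (inj₂ (h , k))) → inj₂ (inj₂ (from r h , from r k)) })
    where
    r : ∀ {u w} → Rel (map (map² φ) es) (φ u) (φ w) ⇔ Rel es u w
    r = Rel-map es

  module _ (_≟_ : DecidableEquality W) (_≟'_ : DecidableEquality W') where
    private
      module C = Count _≟_
      module C' = Count _≟'_

    -- Each copy of a segment in the tower is an injective image of the segment, so this carries the
    -- two weights of a segment over to all its copies.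
    N-map : ∀ D st es → C'.N (map φ D) (map (map² φ) st) (map (map² φ) es) ≡ C.N D st es
    N-map D st [] = indicator-cong (C'.total? (map φ D) (map (map² φ) st)) (C.total? D st) (mk⇔
      (λ t → rel⇒total λ u∈ w∈ → to (Rel-map st) (total⇒rel t (∈-map⁺ φ u∈) (∈-map⁺ φ w∈)))
      (λ t → Allₚ.map⁺ (All.map (Allₚ.map⁺ ∘ All.map (from (Rel-map st))) t)))
    N-map D st ((a , b) ∷ es) = cong₂ _+_ (N-map D st es)
      (unless-cong (C'.rel? _ _ _) (C.rel? st a b) (Rel-map st) λ _ → N-map D ((a , b) ∷ st) es)

-- Gluing along ramified vertices, and parallel edges

module Blocks {W : Set} (_≟_ : DecidableEquality W) where

  open Count _≟_

  -- For the copy of a segment, `cut` will be its number of segmental forests and `join` its number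
  -- of spanning trees.
  record WEdge : Set where
    constructor wedge
    field
      end₁ end₂ : W
      cut join : ℕ

  open WEdge

  -- The spanning trees of the multigraph on R with edge list es, weighted by
  -- join on the edges used and by cut on the others.
  Z : List W → List (W × W) → List WEdge → ℕ
  Z R ρ []                    = indicator (total? R ρ)
  Z R ρ (wedge a b F K ∷ es) =
    F * Z R ρ es + unless (rel? ρ a b) (K * Z R ((a , b) ∷ ρ) es)

  record Block : Set where
    field
      fst snd  : W
      inner    : List W
      edges    : List (W × W)

    vertices : List W
    vertices = fst ∷ snd ∷ inner

    toWEdge : WEdge
    toWEdge = wedge fst snd (N vertices ((fst , snd) ∷ []) edges) (N vertices [] edges)

  open Block

  allVertices : List W → List Block → List W
  allVertices R []       = R
  allVertices R (B ∷ Bs) = inner B ++ allVertices R Bs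

  -- Inner vertices are fresh with respect to `R` and the later blocks only. That is what peeling
  -- off the first block requires: it then meets the rest in `fst` and `snd` alone.
  data WellFormed (R : List W) : List Block → Set where
    []  : WellFormed R []
    cons : ∀ {B Bs} → fst B ∈ₗ R → snd B ∈ₗ R → All (_Within vertices B) (edges B) →
      (∀ {x} → x ∈ₗ inner B → ¬ x ∈ₗ allVertices R Bs) → WellFormed R Bs → WellFormed R (B ∷ Bs)

  R⊆allVertices : ∀ {R} Bs {x} → x ∈ₗ R → x ∈ₗ allVertices R Bs
  R⊆allVertices []       x∈ = x∈
  R⊆allVertices (B ∷ Bs) x∈ = ∈-++⁺ʳ (inner B) (R⊆allVertices Bs x∈)

  vertices⊆allVertices : ∀ {R} B Bs → fst B ∈ₗ R → snd B ∈ₗ R → ∀ {x} → x ∈ₗ vertices B →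
    x ∈ₗ allVertices R (B ∷ Bs)
  vertices⊆allVertices B Bs a∈ b∈ (here refl)         = R⊆allVertices (B ∷ Bs) a∈
  vertices⊆allVertices B Bs a∈ b∈ (there (here refl)) = R⊆allVertices (B ∷ Bs) b∈
  vertices⊆allVertices B Bs a∈ b∈ (there (there x∈))  = ∈-++⁺ˡ x∈

  edges-within : ∀ {R Bs} → WellFormed R Bs → All (_Within allVertices R Bs) (concatMap edges Bs)
  edges-within [] = []
  edges-within (cons {B} {Bs} a∈ b∈ es∈ _ wf) = Allₚ.++⁺
    (All.map (λ (u∈ , w∈) → vertices⊆allVertices B Bs a∈ b∈ u∈ , vertices⊆allVertices B Bs a∈ b∈ w∈) es∈)
    (All.map (λ (u∈ , w∈) → ∈-++⁺ʳ (inner B) u∈ , ∈-++⁺ʳ (inner B) w∈) (edges-within wf))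

  -- Blocks are peeled off one at a time by `N-block`. The state stays inside `R`, since a block
  -- leaves behind at most the pair of its marked vertices.
  N≡Z : ∀ {R Bs} → WellFormed R Bs → ∀ {ρ} → All (_Within R) ρ →
    N (allVertices R Bs) ρ (concatMap edges Bs) ≡ Z R ρ (map toWEdge Bs)
  N≡Z [] ρ∈ = refl
  N≡Z {R} (cons {B} {Bs} a∈ b∈ es∈ disj wf) {ρ} ρ∈ = trans
    (Glue.N-block (fst B) (snd B) (vertices B) D' (inner B ++ D')
      (here refl) (there (here refl)) (R⊆allVertices Bs a∈) (R⊆allVertices Bs b∈)
      A∩B (mk⇔ ([ inj₁ ∘ there ∘ there , inj₂ ]′ ∘ ∈-++⁻ (inner B))
               [ vertices⊆allVertices B Bs a∈ b∈ , ∈-++⁺ʳ (inner B) ]′)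
      es∈ (edges-within wf) (All.map (λ (u∈ , w∈) → R⊆allVertices Bs u∈ , R⊆allVertices Bs w∈) ρ∈))
    (cong₂ (λ x y → N (vertices B) _ (edges B) * x + unless (rel? ρ (fst B) (snd B)) (N (vertices B) [] (edges B) * y))
      (N≡Z wf ρ∈) (N≡Z wf ((a∈ , b∈) ∷ ρ∈)))
    where
    D' = allVertices R Bs
    A∩B : ∀ {x} → x ∈ₗ vertices B → x ∈ₗ D' → x ≡ fst B ⊎ x ≡ snd B
    A∩B (here refl)         _ = inj₁ refl
    A∩B (there (here refl)) _ = inj₂ refl
    A∩B (there (there x∈)) x∈' = ⊥-elim (disj x∈ x∈')

  -- Each class of Rel ρ keeps one representative; adding a pair that is not
  -- yet related discards exactly one of them.
  representatives : ∀ {R} → Unique R → ∀ {ρ} → Acyc ρ → All (_Within R) ρ →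
    ∃[ xs ] (AllPairs (λ u w → ¬ Rel ρ u w) xs × (∀ {x} → x ∈ₗ xs → x ∈ₗ R)
      × (∀ {u} → u ∈ₗ R → ∃[ x ] (x ∈ₗ xs × Rel ρ u x)) × length xs + length ρ ≡ length R)
  representatives {R} uniq {[]} _ _ =
    R , uniq , id , (λ u∈ → _ , u∈ , refl) , +-identityʳ _
  representatives {R} uniq {(a , b) ∷ ρ} (¬ab , acyc) ((a∈ , b∈) ∷ ρ∈)
    with representatives uniq acyc ρ∈
  -- The representative `y` of the class of `b` is dropped; that of the class of `a` serves the
  -- merged class.
  ... | xs , pairs , xs⊆ , cover , len with cover b∈
  ...   | y , y∈ , by with ∈-∃++ y∈
  ...     | ys , zs , refl = ys ++ zs , pairs'' , xs⊆ ∘ ∈-resp-↭ (↭-sym move) ∘ there , cover' ,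
            trans (+-suc (length (ys ++ zs)) (length ρ)) (trans (cong (_+ length ρ) (sym (↭-length move))) len)
    where
    move : ys ++ y ∷ zs ↭ y ∷ ys ++ zs
    move = shift y ys zs
    pairs' : AllPairs (λ u w → ¬ Rel ρ u w) (y ∷ ys ++ zs)
    pairs' = AllPairs-resp-↭ (setoid W) (λ n → n ∘ Rel-sym ρ) (resp₂ _) (↭⇒↭ₛ move) pairs
    unrelated : ∀ {x} → x ∈ₗ ys ++ zs → ¬ Rel ρ x b
    unrelated x∈ h = All.lookup (AllPairs.head pairs') x∈ (Rel-sym ρ (Rel-trans ρ h by))
    pairs'' : AllPairs (λ u w → ¬ Rel ((a , b) ∷ ρ) u w) (ys ++ zs)
    pairs'' = AllPairs-map-∈ (λ u∈ w∈ n → λ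
      { (inj₁ h) → n h
      ; (inj₂ (inj₁ (_ , h))) → unrelated w∈ (Rel-sym ρ h)
      ; (inj₂ (inj₂ (h , _))) → unrelated u∈ h }) (AllPairs.tail pairs')
    cover'' : ∀ {u} → u ∈ₗ R → ¬ Rel ρ u b → ∃[ x ] (x ∈ₗ ys ++ zs × Rel ρ u x)
    cover'' u∈ ¬ub with cover u∈
    ... | x , x∈ , h with ∈-resp-↭ move x∈
    ...   | here refl = ⊥-elim (¬ub (Rel-trans ρ h (Rel-sym ρ by)))
    ...   | there x∈' = x , x∈' , h
    cover' : ∀ {u} → u ∈ₗ R → ∃[ x ] (x ∈ₗ ys ++ zs × Rel ((a , b) ∷ ρ) u x)
    cover' {u} u∈ with rel? ρ u b
    ... | no ¬ub = let x , x∈ , h = cover'' u∈ ¬ub in x , x∈ , inj₁ h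
    ... | yes ub = let x , x∈ , h = cover'' a∈ ¬ab in x , x∈ , inj₂ (inj₂ (ub , h))

  -- In a total state all representatives are related, so there is at most one, and `r` shows that
  -- there is at least one; the count of `representatives` then reads `1 + length ρ ≡ length R`.
  acyc-total-length : ∀ {R ρ r} → Unique R → r ∈ₗ R → Acyc ρ → All (_Within R) ρ → Total R ρ →
    length ρ ≡ length R ∸ 1
  acyc-total-length uniq r∈ acyc ρ∈ t with representatives uniq acyc ρ∈
  ... | [] , _ , _ , cover , _ with () ← proj₁ (proj₂ (cover r∈))
  ... | x ∷ [] , _ , _ , _ , len = cong (_∸ 1) len
  ... | x ∷ y ∷ xs , (¬h ∷ _) ∷ _ , xs⊆ , _ = ⊥-elim (¬h (total⇒rel t (xs⊆ (here refl)) (xs⊆ (there (here refl)))))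

  Z-related : ∀ {R ρ} e k es → Rel ρ (end₁ e) (end₂ e) →
    Z R ρ (replicate k e ++ es) ≡ cut e ^ k * Z R ρ es
  Z-related e zero es h = sym (+-identityʳ _)
  Z-related {R} {ρ} e (suc k) es h = begin
    cut e * Z R ρ (replicate k e ++ es) + unless (rel? ρ (end₁ e) (end₂ e)) _
      ≡⟨ cong₂ (λ x y → cut e * x + y) (Z-related e k es h) (unless-yes (rel? ρ _ _) h) ⟩
    cut e * (cut e ^ k * Z R ρ es) + 0
      ≡⟨ solve 3 (λ x y z → x :* (y :* z) :+ con 0 := x :* y :* z) refl (cut e) (cut e ^ k) (Z R ρ es) ⟩
    cut e ^ suc k * Z R ρ es ∎
    where open ≡-Reasoning

  -- A spanning tree uses at most one of parallel edges.
  Z-parallel : ∀ {R ρ} e k es → ¬ Rel ρ (end₁ e) (end₂ e) →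
    Z R ρ (replicate (suc k) e ++ es) ≡ cut e ^ k *
      (cut e * Z R ρ es + suc k * (join e * Z R ((end₁ e , end₂ e) ∷ ρ) es))
  Z-parallel {R} {ρ} e zero es ¬h = begin
    cut e * Z R ρ es + unless (rel? ρ (end₁ e) (end₂ e)) (join e * Z R ρ' es)
      ≡⟨ cong (cut e * Z R ρ es +_) (unless-no (rel? ρ _ _) ¬h) ⟩
    cut e * Z R ρ es + join e * Z R ρ' es
      ≡⟨ solve 2 (λ x y → x :+ y := con 1 :* (x :+ con 1 :* y)) refl (cut e * Z R ρ es) (join e * Z R ρ' es) ⟩
    1 * (cut e * Z R ρ es + 1 * (join e * Z R ρ' es)) ∎
    where
    open ≡-Reasoning
    ρ' = (end₁ e , end₂ e) ∷ ρ
  Z-parallel {R} {ρ} e (suc k) es ¬h = begin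
    cut e * Z R ρ (replicate (suc k) e ++ es) + unless (rel? ρ (end₁ e) (end₂ e)) (join e * Z R ρ' (replicate (suc k) e ++ es))
      ≡⟨ cong₂ (λ x y → cut e * x + y) (Z-parallel e k es ¬h)
          (trans (unless-no (rel? ρ _ _) ¬h)
            (cong (join e *_) (Z-related e (suc k) es (Rel-edge (here refl))))) ⟩
    cut e * (cut e ^ k * (cut e * Z R ρ es + suc k * (join e * Z R ρ' es))) + join e * (cut e ^ suc k * Z R ρ' es)
      ≡⟨ solve 6 (λ c d z k j z' →
            c :* (d :* (c :* z :+ k :* (j :* z'))) :+ j :* ((c :* d) :* z')
              := (c :* d) :* (c :* z :+ (con 1 :+ k) :* (j :* z')))
          refl (cut e) (cut e ^ k) (Z R ρ es) (suc k) (join e) (Z R ρ' es) ⟩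
    cut e ^ suc k * (cut e * Z R ρ es + suc (suc k) * (join e * Z R ρ' es)) ∎
    where
    open ≡-Reasoning
    ρ' = (end₁ e , end₂ e) ∷ ρ

  -- Every pair in `ρ` records a join already made, and `suc k ^ length ρ` credits the `suc k`
  -- parallel edges that could have made it. Final states that count have exactly `length R ∸ 1`
  -- pairs, so all trees get the same power. Of the `suc k` edges in a class, one contributes its
  -- `join` or `cut` to `Z`, and the other `k` are cut in either case.
  Z-multiply : ∀ {R r} → Unique R → r ∈ₗ R → ∀ k es → All (λ e → (end₁ e , end₂ e) Within R) es →
    ∀ {ρ} → Acyc ρ → All (_Within R) ρ →
    Z R ρ (concatMap (replicate (suc k)) es) * suc k ^ length ρ
      ≡ suc k ^ (length R ∸ 1) * (product (map (λ e → cut e ^ k) es) * Z R ρ es)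
  Z-multiply {R} uniq r∈ k [] _ {ρ} acyc ρ∈ with total? R ρ
  ... | no _  = sym (*-zeroʳ (suc k ^ (length R ∸ 1)))
  ... | yes t rewrite acyc-total-length uniq r∈ acyc ρ∈ t = *-comm 1 (suc k ^ (length R ∸ 1))
  Z-multiply {R} uniq r∈ k (e ∷ es) (e∈ ∷ es∈) {ρ} acyc ρ∈ = split d
    where
    open ≡-Reasoning
    q = suc k
    Q = suc k ^ (length R ∸ 1)
    P = product (map (λ e → cut e ^ k) es)
    es' = concatMap (replicate (suc k)) es
    ρ' = (end₁ e , end₂ e) ∷ ρ
    d = rel? ρ (end₁ e) (end₂ e)
    split : Dec (Rel ρ (end₁ e) (end₂ e)) →
      Z R ρ (replicate (suc k) e ++ es') * q ^ length ρ ≡ Q * (cut e ^ k * P * Z R ρ (e ∷ es))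
    split (yes h) = begin
      Z R ρ (replicate (suc k) e ++ es') * q ^ length ρ
        ≡⟨ cong (_* q ^ length ρ) (Z-related e (suc k) es' h) ⟩
      cut e * cut e ^ k * Z R ρ es' * q ^ length ρ
        ≡⟨ solve 4 (λ c d z y → c :* d :* z :* y := c :* d :* (z :* y))
            refl (cut e) (cut e ^ k) (Z R ρ es') (q ^ length ρ) ⟩
      cut e * cut e ^ k * (Z R ρ es' * q ^ length ρ)
        ≡⟨ cong (cut e * cut e ^ k *_) (Z-multiply uniq r∈ k es es∈ acyc ρ∈) ⟩
      cut e * cut e ^ k * (Q * (P * Z R ρ es))
        ≡⟨ solve 5 (λ c d x y z → c :* d :* (x :* (y :* z)) := x :* (d :* y :* (c :* z :+ con 0)))
            refl (cut e) (cut e ^ k) Q P (Z R ρ es) ⟩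
      Q * (cut e ^ k * P * (cut e * Z R ρ es + 0))
        ≡⟨ cong (λ x → Q * (cut e ^ k * P * (cut e * Z R ρ es + x))) (sym (unless-yes d h)) ⟩
      Q * (cut e ^ k * P * Z R ρ (e ∷ es)) ∎
    split (no ¬h) = begin
      Z R ρ (replicate (suc k) e ++ es') * q ^ length ρ
        ≡⟨ cong (_* q ^ length ρ) (Z-parallel e k es' ¬h) ⟩
      cut e ^ k * (cut e * Z R ρ es' + q * (join e * Z R ρ' es')) * q ^ length ρ
        ≡⟨ solve 7 (λ d c z q j z' y → d :* (c :* z :+ q :* (j :* z')) :* y
              := d :* (c :* (z :* y) :+ j :* (z' :* (q :* y))))
            refl (cut e ^ k) (cut e) (Z R ρ es') q (join e) (Z R ρ' es') (q ^ length ρ) ⟩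
      cut e ^ k * (cut e * (Z R ρ es' * q ^ length ρ) + join e * (Z R ρ' es' * q ^ length ρ'))
        ≡⟨ cong₂ (λ x y → cut e ^ k * (cut e * x + join e * y))
            (Z-multiply uniq r∈ k es es∈ acyc ρ∈)
            (Z-multiply uniq r∈ k es es∈ (¬h , acyc) (e∈ ∷ ρ∈)) ⟩
      cut e ^ k * (cut e * (Q * (P * Z R ρ es)) + join e * (Q * (P * Z R ρ' es)))
        ≡⟨ solve 7 (λ d c x y z j z' → d :* (c :* (x :* (y :* z)) :+ j :* (x :* (y :* z')))
              := x :* (d :* y :* (c :* z :+ j :* z')))
            refl (cut e ^ k) (cut e) Q P (Z R ρ es) (join e) (Z R ρ' es) ⟩
      Q * (cut e ^ k * P * (cut e * Z R ρ es + join e * Z R ρ' es))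
        ≡⟨ cong (λ x → Q * (cut e ^ k * P * (cut e * Z R ρ es + x))) (sym (unless-no d ¬h)) ⟩
      Q * (cut e ^ k * P * Z R ρ (e ∷ es)) ∎

-- Subsets of edges realising the count.

CountIs-unique : ∀ {n k k'} {P Q : Subset n → Set} → CountIs P k → CountIs Q k' →
  (∀ T → P T ⇔ Q T) → k ≡ k'
CountIs-unique (xs , uniq , refl , mem) (ys , uniq' , refl , mem') P⇔Q =
  ↭-length (∼bag⇒↭ (unique∧set⇒bag uniq uniq' λ {T} → mk⇔
    (from (mem' T) ∘ to (P⇔Q T) ∘ to (mem T)) (from (mem T) ∘ from (P⇔Q T) ∘ to (mem' T))))

x∉p-x : ∀ {n} (p : Subset n) x → x ∉ p - x
x∉p-x (inside  ∷ p) zero    ()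
x∉p-x (outside ∷ p) zero    ()
x∉p-x (s ∷ p)       (suc x) (Vec.there x∈) = x∉p-x p x x∈

-∪⁅⁆ : ∀ {n} {T : Subset n} {x} → x ∈ T → (T - x) ∪ ⁅ x ⁆ ≡ T
-∪⁅⁆ {T = T} {x} x∈ = ⊆-antisym
  (λ y∈ → [ p─q⊆p T ⁅ x ⁆ , (λ y∈x → subst (_∈ T) (sym (x∈⁅y⁆⇒x≡y x y∈x)) x∈) ]′ (x∈p∪q⁻ _ _ y∈))
  (λ {y} y∈ → x∈p∪q⁺ (split y∈ (y Data.Fin.≟ x)))
  where
  split : ∀ {y} → y ∈ T → Dec (y ≡ x) → y ∈ T - x ⊎ y ∈ ⁅ x ⁆
  split y∈ (yes refl) = inj₂ (x∈⁅x⁆ x)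
  split y∈ (no y≢x)   = inj₁ (x∈p∧x≢y⇒x∈p-y y∈ y≢x)

∪⁅⁆-cancel : ∀ {n} {T T' : Subset n} {x} → x ∉ T → T ∪ ⁅ x ⁆ ≡ T' ∪ ⁅ x ⁆ → T ⊆ T'
∪⁅⁆-cancel {T = T} {T'} {x} x∉ eq {y} y∈ with x∈p∪q⁻ T' ⁅ x ⁆ (subst (y ∈_) eq (x∈p∪q⁺ (inj₁ y∈)))
... | inj₁ y∈' = y∈'
... | inj₂ y∈x = ⊥-elim (x∉ (subst (_∈ T) (x∈⁅y⁆⇒x≡y x y∈x) y∈))

module _ {n : ℕ} {W : Set} (ends : Fin n → W × W) where

  sel : Subset n → List (Fin n) → List (W × W)
  sel T xs = map ends (filter (_∈? T) xs)

  sel-accept : ∀ T {x} xs → x ∈ T → sel T (x ∷ xs) ≡ ends x ∷ sel T xs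
  sel-accept T xs x∈ = cong (map ends) (filter-accept (_∈? T) x∈)

  sel-reject : ∀ T {x} xs → x ∉ T → sel T (x ∷ xs) ≡ sel T xs
  sel-reject T xs x∉ = cong (map ends) (filter-reject (_∈? T) x∉)

  sel-cong : ∀ {T T'} xs → (∀ {x} → x ∈ₗ xs → x ∈ T ⇔ x ∈ T') → sel T xs ≡ sel T' xs
  sel-cong [] h = refl
  sel-cong {T} {T'} (x ∷ xs) h with x ∈? T
  ... | yes x∈ = trans (cong (ends x ∷_) (sel-cong xs (h ∘ there)))
                   (sym (sel-accept T' xs (to (h (here refl)) x∈)))
  ... | no x∉  = trans (sel-cong xs (h ∘ there))
                   (sym (sel-reject T' xs (x∉ ∘ from (h (here refl)))))

  module _ (_≟_ : DecidableEquality W) (D : List W) where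
    open Count _≟_

    -- The property of subsets that matches a stage of the recursion for `N`: `xs` are the edges
    -- still to be decided, and `st` are the pairs chosen before.
    GoodOver : List (W × W) → List (Fin n) → Subset n → Set
    GoodOver st xs T = (∀ {x} → x ∈ T → x ∈ₗ xs) × Acyc (sel T xs ++ st) × Total D (sel T xs ++ st)

    private
      drop-head : ∀ {x y xs} {T : Subset n} → x ∉ T → y ∈ₗ x ∷ xs → y ∈ T → y ∈ₗ xs
      drop-head x∉ (here refl) y∈ = ⊥-elim (x∉ y∈)
      drop-head x∉ (there y∈)  _  = y∈

      good-skip : ∀ {st x xs T} → x ∉ T → GoodOver st (x ∷ xs) T ⇔ GoodOver st xs T
      good-skip {st} {x} {xs} {T} x∉ = mk⇔
        (λ (sub , ac , tot) → (λ y∈ → drop-head x∉ (sub y∈) y∈) ,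
          subst (λ l → Acyc (l ++ st)) eq ac , subst (λ l → Total D (l ++ st)) eq tot)
        (λ (sub , ac , tot) → there ∘ sub ,
          subst (λ l → Acyc (l ++ st)) (sym eq) ac , subst (λ l → Total D (l ++ st)) (sym eq) tot)
        where
        eq = sel-reject T xs x∉

      good-take : ∀ {st x xs T} → ¬ x ∈ₗ xs → x ∉ T →
        GoodOver st (x ∷ xs) (T ∪ ⁅ x ⁆) ⇔ GoodOver (ends x ∷ st) xs T
      good-take {st} {x} {xs} {T} x∉xs x∉ = mk⇔
        (λ (sub , ac , tot) → (λ y∈ → drop-head x∉ (sub (x∈p∪q⁺ (inj₁ y∈))) y∈) ,
          Acyc-↭ (↭-sym move) (subst (λ l → Acyc (l ++ st)) eq ac) ,
          rel⇒total (λ u∈ w∈ → Rel-⊆ _ (∈-resp-↭ (↭-sym move))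
            (total⇒rel (subst (λ l → Total D (l ++ st)) eq tot) u∈ w∈)))
        (λ (sub , ac , tot) → (λ y∈ → [ there ∘ sub , (λ y∈x → here (x∈⁅y⁆⇒x≡y x y∈x)) ]′ (x∈p∪q⁻ T _ y∈)) ,
          subst (λ l → Acyc (l ++ st)) (sym eq) (Acyc-↭ move ac) ,
          subst (λ l → Total D (l ++ st)) (sym eq)
            (rel⇒total (λ u∈ w∈ → Rel-⊆ _ (∈-resp-↭ move) (total⇒rel tot u∈ w∈))))
        where
        move : sel T xs ++ ends x ∷ st ↭ ends x ∷ sel T xs ++ st
        move = shift (ends x) (sel T xs) st
        eq : sel (T ∪ ⁅ x ⁆) (x ∷ xs) ≡ ends x ∷ sel T xs
        eq = trans (sel-accept (T ∪ ⁅ x ⁆) xs (x∈p∪q⁺ (inj₂ (x∈⁅x⁆ x))))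
          (cong (ends x ∷_) (sel-cong xs λ {y} y∈ → mk⇔
            (λ y∈T → [ id , (λ y∈x → ⊥-elim (x∉xs (subst (_∈ₗ xs) (x∈⁅y⁆⇒x≡y x y∈x) y∈))) ]′ (x∈p∪q⁻ T _ y∈T))
            (x∈p∪q⁺ ∘ inj₁)))

    -- The list of subsets grows along the recursion for `N`: those avoiding the first edge, then
    -- those containing it. If that edge closes a cycle with `st`, the second kind is empty, since
    -- further edges cannot undo a cycle.
    count-good : ∀ {st} xs → Acyc st → Unique xs → CountIs (GoodOver st xs) (N D st (map ends xs))
    count-good {st} [] ac _ with total? D st
    ... | yes t = ∅ ∷ [] , [] ∷ [] , refl , λ T → mk⇔
      (λ { (here refl) → (⊥-elim ∘ ∉⊥) , ac , t })
      (λ (sub , _) → here (Empty-unique λ (_ , x∈) → case-[] (sub x∈)))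
      where
      case-[] : ∀ {x : Fin n} → ¬ x ∈ₗ []
      case-[] ()
    ... | no ¬t = [] , [] , refl , λ T → mk⇔ (λ ()) (λ (_ , _ , t) → ⊥-elim (¬t t))
    count-good {st} (x ∷ xs) ac (x∉ ∷ uniq)
      with rel? st (proj₁ (ends x)) (proj₂ (ends x)) | count-good {st} xs ac uniq
    ... | yes h | ys , uniq-ys , len , mem = ys , uniq-ys , trans len (sym (+-identityʳ _)) , λ T → mk⇔
      (λ T∈ → let good = to (mem T) T∈ in
        from (good-skip λ x∈T → Allₚ.All¬⇒¬Any x∉ (proj₁ good x∈T)) good)
      (λ good → from (mem T) (to (good-skip λ x∈T → absurd good x∈T) good))
      where
      absurd : ∀ {T} → GoodOver st (x ∷ xs) T → x ∉ T
      absurd {T} (_ , ac' , _) x∈ =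
        proj₁ (subst (λ l → Acyc (l ++ st)) (sel-accept T xs x∈) ac') (Rel-⊆ st (∈-++⁺ʳ (sel T xs)) h)
    ... | no ¬h | ys , uniq-ys , len , mem with count-good {ends x ∷ st} xs (¬h , ac) uniq
    ...   | zs , uniq-zs , len' , mem' =
      ys ++ map (_∪ ⁅ x ⁆) zs ,
      Uniqueₚ.++⁺ uniq-ys
        (AllPairsₚ.map⁺ (AllPairs-map-∈ (λ T∈ T'∈ T≢T' eq → T≢T' (⊆-antisym
          (∪⁅⁆-cancel (x∉zs T∈) eq) (∪⁅⁆-cancel (x∉zs T'∈) (sym eq)))) uniq-zs))
        (λ (T∈ , T∈') → disjoint T∈ T∈') ,
      trans (length-++ ys) (cong₂ _+_ len (trans (length-map _ zs) len')) ,
      λ T → mk⇔ (fwd T) (bwd T)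
      where
      x∉xs : ¬ x ∈ₗ xs
      x∉xs = Allₚ.All¬⇒¬Any x∉
      x∉ys : ∀ {T} → T ∈ₗ ys → x ∉ T
      x∉ys {T} T∈ x∈ = x∉xs (proj₁ (to (mem T) T∈) x∈)
      x∉zs : ∀ {T} → T ∈ₗ zs → x ∉ T
      x∉zs {T} T∈ x∈ = x∉xs (proj₁ (to (mem' T) T∈) x∈)
      disjoint : ∀ {T} → T ∈ₗ ys → ¬ T ∈ₗ map (_∪ ⁅ x ⁆) zs
      disjoint T∈ T∈' with ∈-map⁻ (_∪ ⁅ x ⁆) T∈'
      ... | _ , _ , refl = x∉ys T∈ (x∈p∪q⁺ (inj₂ (x∈⁅x⁆ x)))
      fwd : ∀ T → T ∈ₗ ys ++ map (_∪ ⁅ x ⁆) zs → GoodOver st (x ∷ xs) T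
      fwd T T∈ with ∈-++⁻ ys T∈
      ... | inj₁ T∈ys = from (good-skip (x∉ys T∈ys)) (to (mem T) T∈ys)
      ... | inj₂ T∈zs with ∈-map⁻ (_∪ ⁅ x ⁆) T∈zs
      ...   | T' , T'∈ , refl = from (good-take x∉xs (x∉zs T'∈)) (to (mem' T') T'∈)
      bwd : ∀ T → GoodOver st (x ∷ xs) T → T ∈ₗ ys ++ map (_∪ ⁅ x ⁆) zs
      bwd T good = split (x ∈? T)
        where
        split : Dec (x ∈ T) → T ∈ₗ ys ++ map (_∪ ⁅ x ⁆) zs
        split (no x∉T)  = ∈-++⁺ˡ (from (mem T) (to (good-skip x∉T) good))
        split (yes x∈T) = ∈-++⁺ʳ ys (subst (_∈ₗ map (_∪ ⁅ x ⁆) zs) (-∪⁅⁆ x∈T)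
          (∈-map⁺ (_∪ ⁅ x ⁆) (from (mem' (T - x)) (to (good-take x∉xs (x∉p-x T x))
            (subst (GoodOver st (x ∷ xs)) (sym (-∪⁅⁆ x∈T)) good)))))

-- Chains in a graph and generated relations.

module GraphCount (G : Graph) {W : Set} (_≟_ : DecidableEquality W)
  (ι : Graph.Vtx G → W) (ι-injective : ∀ {u w} → ι u ≡ ι w → u ≡ w) where

  open Graph G
  open Count _≟_

  -- Vertices are viewed in `W` through `ι`, so that all levels of the tower can be counted in one
  -- common vertex type, with the same list of ramified vertices.
  ends : Fin nE → W × W
  ends e = ι (src e) , ι (tgt e)

  _≟ᵥ_ : DecidableEquality Vtx
  u ≟ᵥ w = map′ ι-injective (cong ι) (ι u ≟ ι w)

  open import Data.List.Membership.DecPropositional _≟ᵥ_ using () renaming (_∈?_ to _∈ᵥ?_)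

  chain-++ : ∀ {u v w ds ds'} → Chain G u ds v → Chain G v ds' w → Chain G u (ds ++ ds') w
  chain-++ nil               c' = c'
  chain-++ (cons d ds eq c) c' = cons d _ eq (chain-++ c c')

  EdgesIn : (Fin nE → Set) → List (Dart G) → Set
  EdgesIn P = All (P ∘ proj₁)

  chain⇒Rel : ∀ {l u w ds} → Chain G u ds w → EdgesIn (_∈ₗ l) ds → Rel (map ends l) (ι u) (ι w)
  chain⇒Rel {l} nil [] = Rel-refl (map ends l)
  chain⇒Rel {l} (cons (e , true) ds refl c) (e∈ ∷ ds∈) =
    Rel-trans (map ends l) (Rel-edge (∈-map⁺ ends e∈)) (chain⇒Rel c ds∈)
  chain⇒Rel {l} (cons (e , false) ds refl c) (e∈ ∷ ds∈) =
    Rel-trans (map ends l) (Rel-sym (map ends l) (Rel-edge (∈-map⁺ ends e∈))) (chain⇒Rel c ds∈)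

  Rel⇒chain : ∀ l {u w} → Rel (map ends l) (ι u) (ι w) → ∃[ ds ] (Chain G u ds w × EdgesIn (_∈ₗ l) ds)
  Rel⇒chain [] h with refl ← ι-injective h = [] , nil , []
  Rel⇒chain (x ∷ l) = go
    where
    go : ∀ {u w} → Rel (map ends (x ∷ l)) (ι u) (ι w) → ∃[ ds ] (Chain G u ds w × EdgesIn (_∈ₗ x ∷ l) ds)
    go (inj₁ h) = let ds , c , ds∈ = Rel⇒chain l h in ds , c , All.map there ds∈
    go (inj₂ (inj₁ (h , k))) =
      let ds , c , ds∈ = Rel⇒chain l h
          ds' , c' , ds'∈ = Rel⇒chain l k
      in ds ++ (x , true) ∷ ds' , chain-++ c (cons (x , true) _ refl c') ,
         Allₚ.++⁺ (All.map there ds∈) (here refl ∷ All.map there ds'∈)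
    go (inj₂ (inj₂ (h , k))) =
      let ds , c , ds∈ = Rel⇒chain l h
          ds' , c' , ds'∈ = Rel⇒chain l k
      in ds ++ (x , false) ∷ ds' , chain-++ c (cons (x , false) _ refl c') ,
         Allₚ.++⁺ (All.map there ds∈) (here refl ∷ All.map there ds'∈)

  IsSimple : Vtx → List (Dart G) → Set
  IsSimple u ds = Unique (u ∷ map (t G) ds)

  simple-from : ∀ {P : Dart G → Set} {u w x ds} → Chain G u ds w → IsSimple u ds → All P ds →
    x ∈ₗ u ∷ map (t G) ds → ∃[ ds' ] (Chain G x ds' w × IsSimple x ds' × All P ds')
  simple-from c s p (here refl) = _ , c , s , p
  simple-from (cons d ds refl c) (_ ∷ s) (_ ∷ p) (there x∈) = simple-from c s p x∈

  -- Loop erasure, starting from the end: if `u` recurs in the simplified rest, the part before its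
  -- recurrence is discarded.
  simplify : ∀ {P : Dart G → Set} {u w ds} → Chain G u ds w → All P ds →
    ∃[ ds' ] (Chain G u ds' w × IsSimple u ds' × All P ds')
  simplify nil [] = [] , nil , [] ∷ [] , []
  simplify {u = u} (cons d ds eq c) (pd ∷ p) with simplify c p
  ... | ds' , c' , s' , p' with u ∈ᵥ? (t G d ∷ map (t G) ds')
  ...   | yes u∈ = simple-from c' s' p' u∈
  ...   | no u∉  = d ∷ ds' , cons d ds' eq c' , Allₚ.¬Any⇒All¬ _ u∉ ∷ s' , pd ∷ p'

  -- An edge used a second time, in either direction, would have one of the two ends of its first
  -- use as a later target.
  simple⇒uniqueEdges : ∀ {u w ds} → Chain G u ds w → IsSimple u ds → Unique (edgesOf G ds)
  simple⇒uniqueEdges nil _ = []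
  simple⇒uniqueEdges (cons d ds refl c) ((_ ∷ o∉) ∷ s@(t∉ ∷ _)) =
    Allₚ.¬Any⇒All¬ _ fresh ∷ simple⇒uniqueEdges c s
    where
    fresh : ¬ proj₁ d ∈ₗ edgesOf G ds
    fresh e∈ with ∈-map⁻ proj₁ e∈
    ... | d' , d'∈ , eq = clash d d' eq (All.lookup t∉ (∈-map⁺ (t G) d'∈)) (All.lookup o∉ (∈-map⁺ (t G) d'∈))
      where
      clash : ∀ d d' → proj₁ d ≡ proj₁ d' → t G d ≢ t G d' → o G d ≢ t G d' → ⊥
      clash (e , true)  (_ , true)  refl t≢ _  = t≢ refl
      clash (e , true)  (_ , false) refl _  o≢ = o≢ refl
      clash (e , false) (_ , true)  refl _  o≢ = o≢ refl
      clash (e , false) (_ , false) refl t≢ _  = t≢ refl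

  -- A connection between the ends of `x` through other edges shortens to a simple path, which `x`
  -- closes to a cycle. For a loop `x` that path is empty.
  acyclic⇒Acyc : ∀ {T} l → Acyclic G T → Unique l → All (_∈ T) l → Acyc (map ends l)
  acyclic⇒Acyc [] _ _ _ = tt
  acyclic⇒Acyc {T} (x ∷ l) ac (x∉ ∷ uniq) (x∈ ∷ l∈) = ¬rel , acyclic⇒Acyc l ac uniq l∈
    where
    ¬rel : ¬ Rel (map ends l) (ι (src x)) (ι (tgt x))
    ¬rel h with Rel⇒chain l (Rel-sym (map ends l) h)
    ... | ds , c , ds∈ with simplify {P = λ d → proj₁ d ∈ₗ l} c ds∈
    ...   | ds' , c' , s' , ds'∈ = ac (src x , (x , true) , ds' , cons _ _ refl c' ,
      Allₚ.map⁺ (All.map (λ {d} d∈ eq → Allₚ.All¬⇒¬Any x∉ (subst (_∈ₗ l) (sym eq) d∈)) ds'∈)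
        ∷ simple⇒uniqueEdges c' s' , s' , x∈ ∷ All.map (All.lookup l∈) ds'∈)

  -- The first dart of a cycle joins two vertices that the other edges connect.
  Acyc⇒acyclic : ∀ {T} l → (∀ {x} → x ∈ T → x ∈ₗ l) → Acyc (map ends l) → Acyclic G T
  Acyc⇒acyclic {T} l T⊆l ac (u , d@(e , b) , ds , cons _ _ o≡ c , e∉ ∷ _ , _ , e∈ ∷ ds∈)
    with ∈-∃++ (T⊆l e∈)
  ... | ys , zs , refl = ¬rel b o≡ c
    where
    l' = ys ++ zs
    move : ys ++ e ∷ zs ↭ e ∷ l'
    move = shift e ys zs
    acyc : Acyc (map ends (e ∷ l'))
    acyc = Acyc-↭ (↭-map⁺ ends move) ac
    drop : ∀ {y} → y ∈ₗ e ∷ l' → e ≢ y → y ∈ₗ l'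
    drop (here eq)  e≢ = ⊥-elim (e≢ (sym eq))
    drop (there y∈) _  = y∈
    ds∈l' : EdgesIn (_∈ₗ l') ds
    ds∈l' = All.tabulate λ d∈ → drop (∈-resp-↭ move (T⊆l (All.lookup ds∈ d∈))) (All.lookup e∉ (∈-map⁺ proj₁ d∈))
    ¬rel : ∀ b → o G (e , b) ≡ u → Chain G (t G (e , b)) ds u → ⊥
    ¬rel true  refl c = proj₁ acyc (Rel-sym (map ends l') (chain⇒Rel c ds∈l'))
    ¬rel false refl c = proj₁ acyc (chain⇒Rel c ds∈l')

  module _ {xs : List (Fin nE)} {T : Subset nE} (T⊆xs : ∀ {x} → x ∈ T → x ∈ₗ xs) where

    acyclic⇔ : Unique xs → Acyclic G T ⇔ Acyc (sel ends T xs)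
    acyclic⇔ uniq = mk⇔
      (λ ac → acyclic⇒Acyc _ ac (Uniqueₚ.filter⁺ (_∈? T) uniq) (Allₚ.all-filter (_∈? T) xs))
      (Acyc⇒acyclic _ λ x∈ → ∈-filter⁺ (_∈? T) (T⊆xs x∈) x∈)

    conn⇔ : ∀ {u w} → Conn G T u w ⇔ Rel (sel ends T xs) (ι u) (ι w)
    conn⇔ = mk⇔
      (λ (ds , c , ds∈) → chain⇒Rel c (All.map (λ x∈ → ∈-filter⁺ (_∈? T) (T⊆xs x∈) x∈) ds∈))
      (λ h → let ds , c , ds∈ = Rel⇒chain _ h in
        ds , c , All.map (λ x∈ → proj₂ (∈-filter⁻ (_∈? T) {xs = xs} x∈)) ds∈)

  numSpanningTrees≡N : ∀ {κ xs D} → NumSpanningTrees G κ → Unique xs → (∀ e → e ∈ₗ xs) →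
    (∀ u → ι u ∈ₗ D) → (∀ {x} → x ∈ₗ D → ∃[ u ] ι u ≡ x) → κ ≡ N D [] (map ends xs)
  numSpanningTrees≡N {κ} {xs} {D} count uniq complete ι∈ D⊆ =
    CountIs-unique count (count-good ends _≟_ D xs tt uniq) λ T → mk⇔
      (λ (ac , conn) → (λ {x} _ → complete x) ,
        subst Acyc (sym (++-identityʳ _)) (to (acyclic⇔ (λ {x} _ → complete x) uniq) ac) ,
        subst (Total D) (sym (++-identityʳ _)) (rel⇒total (total T conn)))
      (λ (sub , ac , tot) → from (acyclic⇔ sub uniq) (subst Acyc (++-identityʳ _) ac) ,
        λ u w → from (conn⇔ sub) (total⇒rel (subst (Total D) (++-identityʳ _) tot) (ι∈ u) (ι∈ w)))
    where
    total : ∀ T → (∀ u w → Conn G T u w) → ∀ {x y} → x ∈ₗ D → y ∈ₗ D → Rel (sel ends T xs) x y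
    total T conn x∈ y∈ with D⊆ x∈ | D⊆ y∈
    ... | u , refl | w , refl = to (conn⇔ (λ {x} _ → complete x)) (conn u w)

-- Segmental forests as trees with a virtual edge.

module SegmentCount (G : Graph) (_≟_ : DecidableEquality (Graph.Vtx G)) (Ram : Graph.Vtx G → Set) where

  open Graph G
  open Count _≟_
  open Marked G Ram
  open GraphCount G _≟_ id id

  -- For distinct `a` and `b`, a segmental forest becomes a spanning tree of the segment when the
  -- virtual edge `(a , b)` is added, and removing that edge gives the forest back. For `a ≡ b` the
  -- virtual edge is a loop and cannot belong to an acyclic state; the count then starts from the
  -- empty state, and `agree-related` inserts the loop afterwards.
  numSegmentalForests≡N : ∀ {S F a b D xs} → NumSegmentalForests S F →
    (∀ {w} → w ∈ₗ D ⇔ SegVertex S w) → SegMarked S a → SegMarked S b →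
    (∀ {m} → SegMarked S m → m ≡ a ⊎ m ≡ b) →
    Unique xs → (∀ {e} → e ∈ₗ xs ⇔ e ∈ S) →
    F ≡ N D ((a , b) ∷ []) (map ends xs)
  numSegmentalForests≡N {S} {F} {a} {b} {D} {xs} count D⇔ ma mb marked uniq xs⇔ = split (a ≟ b)
    where
    xs∈D : All (_Within D) (map ends xs)
    xs∈D = Allₚ.map⁺ (All.tabulate λ {e} e∈ →
      from D⇔ (e , to xs⇔ e∈ , inj₁ refl) , from D⇔ (e , to xs⇔ e∈ , inj₂ refl))

    toS : ∀ {T} → (∀ {x} → x ∈ T → x ∈ₗ xs) → T ⊆ S
    toS sub x∈ = to xs⇔ (sub x∈)

    toxs : ∀ {T} → T ⊆ S → ∀ {x} → x ∈ T → x ∈ₗ xs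
    toxs sub x∈ = from xs⇔ (sub x∈)

    split : Dec (a ≡ b) → F ≡ N D ((a , b) ∷ []) (map ends xs)
    split (yes refl) = trans
      (CountIs-unique count (count-good ends _≟_ D xs tt uniq) λ T → mk⇔
        (λ (T⊆ , ac , attached , _) → toxs T⊆ ,
          subst Acyc (sym (++-identityʳ _)) (to (acyclic⇔ (toxs T⊆) uniq) ac) ,
          subst (Total D) (sym (++-identityʳ _)) (rel⇒total λ u∈ w∈ →
            let r = λ {z} (z∈ : z ∈ₗ D) → toa (toxs T⊆) attached z∈
            in Rel-trans (sel ends T xs) (r u∈) (Rel-sym (sel ends T xs) (r w∈))))
        (λ (sub , ac , tot) → toS sub , from (acyclic⇔ sub uniq) (subst Acyc (++-identityʳ _) ac) ,
          (λ w w∈ → a , ma , from (conn⇔ sub)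
            (total⇒rel (subst (Total D) (++-identityʳ _) tot) (from D⇔ w∈) (from D⇔ (proj₁ ma)))) ,
          λ m m' mm mm' _ → trans (same (marked mm)) (sym (same (marked mm')))))
      (sym (N-agree (map ends xs) xs∈D (agree-related refl)))
      where
      same : ∀ {m} → m ≡ a ⊎ m ≡ a → m ≡ a
      same = [ id , id ]′
      toa : ∀ {T} (sub : ∀ {x} → x ∈ T → x ∈ₗ xs) →
        (∀ w → SegVertex S w → ∃[ m ] (SegMarked S m × Conn G T w m)) →
        ∀ {w} → w ∈ₗ D → Rel (sel ends T xs) w a
      toa sub attached w∈ with attached _ (to D⇔ w∈)
      ... | m , mm , c with refl ← same (marked mm) = to (conn⇔ sub) c
    split (no a≢b) = CountIs-unique count (count-good ends _≟_ D xs (a≢b , tt) uniq) λ T → mk⇔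
      (λ (T⊆ , ac , attached , separate) → toxs T⊆ ,
        Acyc-↭ (++-comm ((a , b) ∷ []) (sel ends T xs))
          ((λ h → a≢b (separate a b ma mb (from (conn⇔ (toxs T⊆)) h))) , to (acyclic⇔ (toxs T⊆) uniq) ac) ,
        rel⇒total λ u∈ w∈ →
          let st = sel ends T xs ++ (a , b) ∷ []
              r = λ {z} (z∈ : z ∈ₗ D) → toa (toxs T⊆) attached z∈
          in Rel-trans st (r u∈) (Rel-sym st (r w∈)))
      (λ (sub , ac , tot) →
        let ¬ab , ac' = Acyc-↭ (++-comm (sel ends T xs) ((a , b) ∷ [])) ac
        in toS sub , from (acyclic⇔ sub uniq) ac' ,
          (λ w w∈ → attach sub (Rel-⊆ _ (∈-resp-↭ (++-comm (sel ends T xs) _))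
            (total⇒rel tot (from D⇔ w∈) (from D⇔ (proj₁ ma))))) ,
          λ m m' mm mm' c → sep ¬ab (marked mm) (marked mm') (to (conn⇔ sub) c))
      where
      toa : ∀ {T} (sub : ∀ {x} → x ∈ T → x ∈ₗ xs) →
        (∀ w → SegVertex S w → ∃[ m ] (SegMarked S m × Conn G T w m)) →
        ∀ {w} → w ∈ₗ D → Rel (sel ends T xs ++ (a , b) ∷ []) w a
      toa {T} sub attached w∈ with attached _ (to D⇔ w∈)
      ... | m , mm , c with marked mm
      ...   | inj₁ refl = Rel-⊆ (sel ends T xs) ∈-++⁺ˡ (to (conn⇔ sub) c)
      ...   | inj₂ refl = let st = sel ends T xs ++ (a , b) ∷ [] in
        Rel-trans st (Rel-⊆ (sel ends T xs) ∈-++⁺ˡ (to (conn⇔ sub) c))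
          (Rel-sym st (Rel-edge (∈-++⁺ʳ (sel ends T xs) (here refl))))
      attach : ∀ {T w} (sub : ∀ {x} → x ∈ T → x ∈ₗ xs) →
        Rel ((a , b) ∷ sel ends T xs) w a → ∃[ m ] (SegMarked S m × Conn G T w m)
      attach sub (inj₁ h)              = a , ma , from (conn⇔ sub) h
      attach sub (inj₂ (inj₁ (h , _))) = a , ma , from (conn⇔ sub) h
      attach sub (inj₂ (inj₂ (h , _))) = b , mb , from (conn⇔ sub) h
      sep : ∀ {es m m'} → ¬ Rel es a b → m ≡ a ⊎ m ≡ b → m' ≡ a ⊎ m' ≡ b → Rel es m m' → m ≡ m'
      sep _        (inj₁ refl) (inj₁ refl) _ = refl
      sep ¬h       (inj₁ refl) (inj₂ refl) h = ⊥-elim (¬h h)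
      sep {es} ¬h  (inj₂ refl) (inj₁ refl) h = ⊥-elim (¬h (Rel-sym es h))
      sep _        (inj₂ refl) (inj₂ refl) _ = refl

-- Segments

∈≡ : {A : Set} {x : A} {xs ys : List A} → xs ≡ ys → x ∈ₗ xs → x ∈ₗ ys
∈≡ refl = id

unique-++⁻ : {A : Set} (xs : List A) {ys : List A} → Unique (xs ++ ys) →
  Unique xs × Unique ys × Disjoint xs ys
unique-++⁻ []       u        = [] , u , λ ()
unique-++⁻ (x ∷ xs) (x∉ ∷ u) with unique-++⁻ xs u
... | u₁ , u₂ , disj = Allₚ.++⁻ˡ xs x∉ ∷ u₁ , u₂ ,
  λ { (here refl , y∈) → All.lookup (Allₚ.++⁻ʳ xs x∉) y∈ refl
    ; (there z∈ , y∈) → disj (z∈ , y∈) }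

¬¬-∀ : ∀ {n} {P : Fin n → Set} → (∀ i → ¬ ¬ P i) → ¬ ¬ (∀ i → P i)
¬¬-∀ {ℕ.zero}  h k = k λ ()
¬¬-∀ {ℕ.suc n} h k = h zero λ p → ¬¬-∀ (h ∘ suc) λ ps → k λ { zero → p ; (suc i) → ps i }

comprehension : ∀ {n} {P : Fin n → Set} → (∀ i → Dec (P i)) → ∃[ S ] (∀ i → i ∈ S ⇔ P i)
comprehension {P = P} P? = Vec.tabulate (does ∘ P?) , λ i → mk⇔
  (λ i∈ → witness i (trans (sym (lookup∘tabulate (does ∘ P?) i)) ([]=⇒lookup i∈)))
  (λ p → lookup⇒[]= i _ (trans (lookup∘tabulate (does ∘ P?) i) (dec-true (P? i) p)))
  where
  witness : ∀ i → does (P? i) ≡ true → P i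
  witness i eq with yes p ← P? i = p

module Segments (G : Graph) (_≟_ : DecidableEquality (Graph.Vtx G))
  (Ram : Graph.Vtx G → Set) (ram? : ∀ v → Dec (Ram v)) where

  open Graph G
  open Marked G Ram
  open GraphCount G _≟_ id id using (chain-++; IsSimple; simple⇒uniqueEdges)
  open import Data.List.Membership.DecPropositional _≟_ using () renaming (_∈?_ to _∈ᵥ?_)
  open import Data.List.Membership.DecPropositional (Fin._≟_ {nE}) using () renaming (_∈?_ to _∈ₑ?_)

  private
    tG : Dart G → Vtx
    tG = t G
    oG : Dart G → Vtx
    oG = o G

  Incident : Fin nE → Vtx → Set
  Incident e w = src e ≡ w ⊎ tgt e ≡ w

  incident-t : ∀ d → Incident (proj₁ d) (tG d)
  incident-t (e , true)  = inj₂ refl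
  incident-t (e , false) = inj₁ refl

  incident-o : ∀ d → Incident (proj₁ d) (oG d)
  incident-o (e , true)  = inj₁ refl
  incident-o (e , false) = inj₂ refl

  incident⇒ : ∀ d {w} → Incident (proj₁ d) w → oG d ≡ w ⊎ tG d ≡ w
  incident⇒ (e , true)  = id
  incident⇒ (e , false) = [ inj₂ , inj₁ ]′

  origin∈ : ∀ {u w ds d} → Chain G u ds w → d ∈ₗ ds → oG d ∈ₗ u ∷ map tG ds
  origin∈ (cons d ds eq c) (here refl) = here eq
  origin∈ (cons d ds eq c) (there d∈)  = there (origin∈ c d∈)

  incident∈ : ∀ {u w x ds e} → Chain G u ds w → e ∈ₗ edgesOf G ds → Incident e x →
    x ∈ₗ u ∷ map tG ds
  incident∈ c e∈ inc with ∈-map⁻ proj₁ e∈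
  ... | d , d∈ , refl with incident⇒ d inc
  ...   | inj₁ refl = origin∈ c d∈
  ...   | inj₂ refl = there (∈-map⁺ tG d∈)

  interior-++ : ∀ ds d ds' → interior G (ds ++ d ∷ ds') ≡ map tG ds ++ interior G (d ∷ ds')
  interior-++ []            d ds' = refl
  interior-++ (d₁ ∷ [])     d ds' = refl
  interior-++ (d₁ ∷ d₂ ∷ ds) d ds' = cong (tG d₁ ∷_) (interior-++ (d₂ ∷ ds) d ds')

  interior-snoc : ∀ {u w d ds} → Chain G u (d ∷ ds) w → map tG (d ∷ ds) ≡ interior G (d ∷ ds) ++ w ∷ []
  interior-snoc (cons d [] eq nil)             = refl
  interior-snoc (cons d (d' ∷ ds) eq c)        = cong (tG d ∷_) (interior-snoc c)

  target⇒ : ∀ {u w x ds} → Chain G u ds w → x ∈ₗ map tG ds → x ∈ₗ interior G ds ⊎ x ≡ w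
  target⇒ {ds = d ∷ ds} c x∈ with ∈-++⁻ (interior G (d ∷ ds)) (∈≡ (interior-snoc c) x∈)
  ... | inj₁ x∈'        = inj₁ x∈'
  ... | inj₂ (here eq) = inj₂ eq

  interior⊆ : ∀ {u w x} ds → Chain G u ds w → x ∈ₗ interior G ds → x ∈ₗ map tG ds
  interior⊆ (d ∷ ds) c x∈ = ∈≡ (sym (interior-snoc c)) (∈-++⁺ˡ x∈)

  end∈ : ∀ {u w d ds} → Chain G u (d ∷ ds) w → w ∈ₗ map tG (d ∷ ds)
  end∈ {d = d} {ds} c = ∈≡ (sym (interior-snoc c)) (∈-++⁺ʳ (interior G (d ∷ ds)) (here refl))

  split-at : ∀ {u w x ds} → Chain G u ds w → x ∈ₗ map tG ds →
    ∃[ d ] ∃[ ds₁ ] ∃[ ds₂ ] (ds ≡ d ∷ ds₁ ++ ds₂ × Chain G u (d ∷ ds₁) x × Chain G x ds₂ w)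
  split-at (cons d ds eq c) (here refl) = d , [] , ds , refl , cons d [] eq nil , c
  split-at (cons d ds eq c) (there x∈) with split-at c x∈
  ... | d' , ds₁ , ds₂ , refl , c₁ , c₂ = d , d' ∷ ds₁ , ds₂ , refl , cons d _ eq c₁ , c₂

  first-hit : ∀ {M : Vtx → Set} → (∀ x → Dec (M x)) → ∀ {v w p} → Chain G v p w → M w →
    ∃[ x ] ∃[ p₁ ] ∃[ p₂ ] (p ≡ p₁ ++ p₂ × Chain G v p₁ x × M x × All (λ d → ¬ M (oG d)) p₁)
  first-hit M? {v} c Mw with M? v
  first-hit M? c Mw | yes Mv = _ , [] , _ , refl , nil , Mv , []
  first-hit M? nil Mw | no ¬Mv = ⊥-elim (¬Mv Mw)
  first-hit M? (cons d ds refl c) Mw | no ¬Mv with first-hit M? c Mw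
  ... | x , p₁ , p₂ , refl , c₁ , Mx , ¬M = x , d ∷ p₁ , p₂ , refl , cons d p₁ refl c₁ , Mx , ¬Mv ∷ ¬M

  target⇒origin : ∀ {v x z p} → Chain G v p x → z ∈ₗ map tG p → z ≡ x ⊎ ∃[ d ] (d ∈ₗ p × oG d ≡ z)
  target⇒origin (cons d [] eq nil) (here refl) = inj₁ refl
  target⇒origin (cons d (d' ∷ ds) eq (cons _ _ eq' c)) (here refl) = inj₂ (d' , there (here refl) , eq')
  target⇒origin (cons d ds eq c) (there z∈) with target⇒origin c z∈
  ... | inj₁ eq'              = inj₁ eq'
  ... | inj₂ (d' , d'∈ , eq') = inj₂ (d' , there d'∈ , eq')

  -- A route along an initial part of `p` and then a final part of `q`. Both parts are nonempty, so
  -- it shares the edge of `d₁` with `p` and that of `d₂` with `q`, which is what links the classes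
  -- of the two paths.
  record Splice (v : Vtx) (p q : List (Dart G)) (y : Vtx) : Set where
    field
      d₁ d₂     : Dart G
      p₁ p₂     : List (Dart G)
      q₁ q₂     : List (Dart G)
      x         : Vtx
      p≡        : p ≡ d₁ ∷ p₁ ++ p₂
      q≡        : q ≡ q₁ ++ d₂ ∷ q₂
      chain₁    : Chain G v (d₁ ∷ p₁) x
      chain₂    : Chain G x (d₂ ∷ q₂) y
      distinct  : Unique (map tG (d₁ ∷ p₁ ++ d₂ ∷ q₂))
      unram-x   : Unram x
      x∈q       : x ∈ₗ map tG q

    darts : List (Dart G)
    darts = p₁ ++ d₂ ∷ q₂

    chain : Chain G v (d₁ ∷ darts) y
    chain = chain-++ chain₁ chain₂

    targets₁ : ∀ {z} → z ∈ₗ map tG (d₁ ∷ p₁) → z ∈ₗ map tG p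
    targets₁ z∈ = ∈≡ (cong (map tG) (sym p≡))
      (∈≡ (sym (map-++ tG (d₁ ∷ p₁) p₂)) (∈-++⁺ˡ z∈))

    targets₂ : ∀ {z} → z ∈ₗ map tG (d₂ ∷ q₂) → z ∈ₗ map tG q
    targets₂ z∈ = ∈≡ (cong (map tG) (sym q≡))
      (∈≡ (sym (map-++ tG q₁ (d₂ ∷ q₂))) (∈-++⁺ʳ (map tG q₁) z∈))

    interior₂ : ∀ {z} → z ∈ₗ interior G (d₂ ∷ q₂) → z ∈ₗ interior G q
    interior₂ z∈ = ∈≡ (cong (interior G) (sym q≡))
      (∈≡ (sym (interior-++ q₁ d₂ q₂)) (∈-++⁺ʳ (map tG q₁) z∈))

    interior⇒ : ∀ {z} → z ∈ₗ interior G (d₁ ∷ darts) → z ∈ₗ map tG p ⊎ z ∈ₗ interior G q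
    interior⇒ z∈ with ∈-++⁻ (map tG (d₁ ∷ p₁)) (∈≡ (interior-++ (d₁ ∷ p₁) d₂ q₂) z∈)
    ... | inj₁ z∈₁ = inj₁ (targets₁ z∈₁)
    ... | inj₂ z∈₂ = inj₂ (interior₂ z∈₂)

    target⇒′ : ∀ {z} → z ∈ₗ map tG (d₁ ∷ darts) → z ∈ₗ map tG p ⊎ z ∈ₗ map tG q
    target⇒′ z∈ with ∈-++⁻ (map tG (d₁ ∷ p₁)) (∈≡ (map-++ tG (d₁ ∷ p₁) (d₂ ∷ q₂)) z∈)
    ... | inj₁ z∈₁ = inj₁ (targets₁ z∈₁)
    ... | inj₂ z∈₂ = inj₂ (targets₂ z∈₂)

    edge₁ : proj₁ d₁ ∈ₗ edgesOf G p
    edge₁ = ∈≡ (cong (edgesOf G) (sym p≡)) (here refl)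

    edge₂ : proj₁ d₂ ∈ₗ edgesOf G q
    edge₂ = ∈≡ (cong (edgesOf G) (sym q≡)) (∈-map⁺ proj₁ (∈-++⁺ʳ q₁ (here refl)))

    edge₂∈ : proj₁ d₂ ∈ₗ edgesOf G (d₁ ∷ darts)
    edge₂∈ = ∈-map⁺ proj₁ (∈-++⁺ʳ (d₁ ∷ p₁) (here refl))

  -- Follow p up to the first unramified vertex of q, then follow q.
  splice : ∀ {v w u y p q} → Ram v → Unram w → Ram y →
    Chain G v p w → Unique (map tG p) → All Unram (map tG p) →
    Chain G u q y → Unique (map tG q) → w ∈ₗ map tG q → Splice v p q y
  splice {v} {w} {u} {y} {p} {q} rv ¬rw ry c Up ¬rp cq Uq w∈
    with first-hit {M = λ z → z ∈ₗ map tG q × Unram z} (λ z → (z ∈ᵥ? map tG q) ×-dec ¬? (ram? z)) c (w∈ , ¬rw)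
  -- The stop `x` is unramified while `v` and `y` are ramified; hence neither part of the route is
  -- empty.
  ... | x , [] , _ , _ , nil , (_ , ¬rx) , _ = ⊥-elim (¬rx rv)
  ... | x , d₁ ∷ p₁ , p₂ , refl , c₁ , (x∈ , ¬rx) , ¬M with split-at cq x∈
  ...   | d , q₁ , [] , refl , _ , nil = ⊥-elim (¬rx ry)
  ...   | d , q₁ , d₂ ∷ q₂ , refl , cx , c₂ = record
    { d₁ = d₁ ; d₂ = d₂ ; p₁ = p₁ ; p₂ = p₂ ; q₁ = d ∷ q₁ ; q₂ = q₂ ; x = x ; p≡ = refl ; q≡ = refl
    ; chain₁ = c₁ ; chain₂ = c₂ ; unram-x = ¬rx ; x∈q = x∈
    ; distinct = subst Unique (sym (map-++ tG (d₁ ∷ p₁) (d₂ ∷ q₂)))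
        (Uniqueₚ.++⁺ (proj₁ (unique-++⁻ _ Up')) (proj₁ (proj₂ Uq')) disj) }
    where
    Up' : Unique (map tG (d₁ ∷ p₁) ++ map tG p₂)
    Up' = subst Unique (map-++ tG (d₁ ∷ p₁) p₂) Up
    Uq' : Unique (map tG (d ∷ q₁)) × Unique (map tG (d₂ ∷ q₂)) × Disjoint (map tG (d ∷ q₁)) (map tG (d₂ ∷ q₂))
    Uq' = unique-++⁻ (map tG (d ∷ q₁)) (subst Unique (map-++ tG (d ∷ q₁) (d₂ ∷ q₂)) Uq)
    in-q : ∀ {z} → z ∈ₗ map tG (d₂ ∷ q₂) → z ∈ₗ map tG (d ∷ q₁ ++ d₂ ∷ q₂)
    in-q z∈ = ∈≡ (sym (map-++ tG (d ∷ q₁) (d₂ ∷ q₂))) (∈-++⁺ʳ (map tG (d ∷ q₁)) z∈)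
    disj : Disjoint (map tG (d₁ ∷ p₁)) (map tG (d₂ ∷ q₂))
    -- If the common vertex is `x`, then `q` visits `x` twice. Otherwise it is the origin of a dart
    -- before the stop, and it would have been an earlier stop.
    disj {z} (z∈₁ , z∈₂) with target⇒origin c₁ z∈₁
    ... | inj₁ refl = proj₂ (proj₂ Uq') (end∈ cx , z∈₂)
    ... | inj₂ (d' , d'∈ , refl) = All.lookup ¬M d'∈ (in-q z∈₂ ,
      All.lookup ¬rp (∈≡ (sym (map-++ tG (d₁ ∷ p₁) p₂)) (∈-++⁺ˡ z∈₁)))

  flip : Dart G → Dart G
  flip (e , b) = e , not b

  rev : List (Dart G) → List (Dart G)
  rev []       = []
  rev (d ∷ ds) = rev ds ++ flip d ∷ []

  o-flip : ∀ d → oG (flip d) ≡ tG d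
  o-flip (e , true)  = refl
  o-flip (e , false) = refl

  t-flip : ∀ d → tG (flip d) ≡ oG d
  t-flip (e , true)  = refl
  t-flip (e , false) = refl

  chain-rev : ∀ {u w ds} → Chain G u ds w → Chain G w (rev ds) u
  chain-rev nil                 = nil
  chain-rev (cons d ds refl c) =
    chain-++ (chain-rev c) (cons (flip d) [] (o-flip d) (subst (λ z → Chain G z [] (oG d)) (sym (t-flip d)) nil))

  rev∈ : ∀ {ds d} → d ∈ₗ rev ds → ∃[ d' ] (d' ∈ₗ ds × d ≡ flip d')
  rev∈ {d' ∷ ds} d∈ with ∈-++⁻ (rev ds) d∈
  ... | inj₁ d∈'         = let d'' , d''∈ , eq = rev∈ d∈' in d'' , there d''∈ , eq
  ... | inj₂ (here refl) = d' , here refl , refl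

  ∈rev : ∀ {ds d} → d ∈ₗ ds → flip d ∈ₗ rev ds
  ∈rev {d ∷ ds} (here refl) = ∈-++⁺ʳ (rev ds) (here refl)
  ∈rev {d ∷ ds} (there d∈)  = ∈-++⁺ˡ (∈rev d∈)

  rev-targets : ∀ {u w ds z} → Chain G u ds w → z ∈ₗ w ∷ map tG (rev ds) → z ∈ₗ u ∷ map tG ds
  rev-targets {ds = []} nil (here refl) = here refl
  rev-targets {ds = d ∷ ds} c (here refl) = there (end∈ c)
  rev-targets c (there z∈) with ∈-map⁻ tG z∈
  ... | d , d∈ , refl with rev∈ d∈
  ...   | d' , d'∈ , refl = subst (_∈ₗ _) (sym (t-flip d')) (origin∈ c d'∈)

  simple-rev : ∀ {u w ds} → Chain G u ds w → IsSimple u ds → IsSimple w (rev ds)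
  simple-rev nil s = s
  simple-rev {w = w} (cons d ds refl c) (o∉ ∷ s) =
    subst (λ l → Unique (w ∷ l)) (sym (map-++ tG (rev ds) (flip d ∷ [])))
      (Uniqueₚ.++⁺ (simple-rev c s) ([] ∷ [])
        λ { (z∈ , here refl) → All.lookup o∉ (rev-targets c z∈) (sym (t-flip d)) })

  open AdmPath
  open ClosedPath using (v; d; ds'; ramV; uniqE; uniqV) renaming (chain to cchain; inter to cinter)

  adm-targets : ∀ P {z} → z ∈ₗ map tG (ds P) → Unram z ⊎ z ≡ b P
  adm-targets P z∈ = [ inj₁ ∘ All.lookup (inter P) , inj₂ ]′ (target⇒ (proj₁ (path P)) z∈)

  adm-vertex : ∀ P {z} → z ∈ₗ a P ∷ map tG (ds P) → Ram z → z ≡ a P ⊎ z ≡ b P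
  adm-vertex P (here eq)  _ = inj₁ eq
  adm-vertex P (there z∈) r = inj₂ ([ (λ ¬r → ⊥-elim (¬r r)) , id ]′ (adm-targets P z∈))

  reverse-adm : AdmPath → AdmPath
  reverse-adm P = record
    { a = b P ; b = a P ; ds = rev (ds P) ; ramA = ramB P ; ramB = ramA P ; a≢b = a≢b P ∘ sym
    ; path = c' , s' , simple⇒uniqueEdges c' s'
    ; inter = All.tabulate λ z∈ → unram (interior⊆ (rev (ds P)) c' z∈) z∈ }
    where
    c = proj₁ (path P)
    c' = chain-rev c
    s' = simple-rev c (proj₁ (proj₂ (path P)))
    not-last : ∀ ds {z} → Chain G (b P) ds (a P) → IsSimple (b P) ds → z ∈ₗ interior G ds → z ≢ a P
    not-last (d ∷ ds) c (_ ∷ s) z∈ refl =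
      proj₂ (proj₂ (unique-++⁻ (interior G (d ∷ ds)) (subst Unique (interior-snoc c) s))) (z∈ , here refl)
    unram : ∀ {z} → z ∈ₗ map tG (rev (ds P)) → z ∈ₗ interior G (rev (ds P)) → Unram z
    unram z∈ z∈' r with adm-vertex P (rev-targets c (there z∈)) r
    ... | inj₁ z≡a = not-last (rev (ds P)) c' s' z∈' z≡a
    ... | inj₂ z≡b = All.lookup (AllPairs.head s') z∈ (sym z≡b)

  Step2-sym : ∀ {P Q} → Step2 P Q → Step2 Q P
  Step2-sym (inj₁ (p , q) , e , e∈ , e∈') = inj₁ (sym p , sym q) , e , e∈' , e∈
  Step2-sym (inj₂ (p , q) , e , e∈ , e∈') = inj₂ (sym q , sym p) , e , e∈' , e∈

  Step1-sym : ∀ {C D} → Step1 C D → Step1 D C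
  Step1-sym (p , e , e∈ , e∈') = sym p , e , e∈' , e∈

  star2-sym : ∀ {P Q} → Star Step2 P Q → Star Step2 Q P
  star2-sym = reverse (λ {P} {Q} → Step2-sym {P} {Q})

  star1-sym : ∀ {C D} → Star Step1 C D → Star Step1 D C
  star1-sym = reverse (λ {C} {D} → Step1-sym {C} {D})

  Step2-reverse : ∀ P → Step2 (reverse-adm P) P
  Step2-reverse P with ds P | proj₁ (path P)
  ... | []     | nil = ⊥-elim (a≢b P refl)
  ... | d ∷ ds | _   = inj₂ (refl , refl) , proj₁ d , ∈-map⁺ proj₁ (∈rev {d ∷ ds} (here refl)) , here refl

  interior-targets : ∀ {Q : Vtx → Set} {w y} ds {ds'} → w ≢ y → Chain G w ds' y →
    All Q (interior G (ds ++ ds')) → All Q (map tG ds)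
  interior-targets ds w≢y nil              int = ⊥-elim (w≢y refl)
  interior-targets ds _   (cons d ds' _ _) int =
    Allₚ.++⁻ˡ (map tG ds) (subst (All _) (interior-++ ds d ds') int)

  -- Distinct segments share no edge and no unramified vertex.

  module Decomposition (decomp : HasSegmentDecomposition) where

    samePair : ∀ P Q → ShareEdge (ds P) (ds Q) → SamePair P Q
    samePair = proj₁ decomp

    step2 : ∀ P Q {e} → e ∈ₗ edgesOf G (ds P) → e ∈ₗ edgesOf G (ds Q) → Step2 P Q
    step2 P Q e∈ e∈' = samePair P Q (_ , e∈ , e∈') , _ , e∈ , e∈'

    -- The two paths are not assumed to join the same pair. The spliced path `R` from `a P` to `b Q`
    -- is admissible because its ends differ, and it shares an edge with each of them; part (a) of
    -- the decomposition then forces all pairs to agree.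
    link : ∀ P Q {w} → a P ≢ b Q → Unram w → w ∈ₗ map tG (ds P) → w ∈ₗ map tG (ds Q) → Star Step2 P Q
    link P Q {w} a≢ ¬rw w∈ w∈' with split-at (proj₁ (path P)) w∈
    ... | d , ds₁ , ds₂ , eq , c₁ , c₂ = _◅_ {j = R} (step2 P R (in-P edge₁) (here refl)) (step2 R Q edge₂∈ edge₂ ◅ ε)
      where
      distinctP : Unique (map tG (d ∷ ds₁) ++ map tG ds₂)
      distinctP = subst Unique (map-++ tG (d ∷ ds₁) ds₂)
        (subst (λ l → Unique (map tG l)) eq (AllPairs.tail (proj₁ (proj₂ (path P)))))
      unram₁ : All Unram (map tG (d ∷ ds₁))
      unram₁ = interior-targets (d ∷ ds₁) (λ { refl → ¬rw (ramB P) }) c₂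
        (subst (λ l → All Unram (interior G l)) eq (inter P))
      sp : Splice (a P) (d ∷ ds₁) (ds Q) (b Q)
      sp = splice (ramA P) ¬rw (ramB Q) c₁ (proj₁ (unique-++⁻ _ distinctP)) unram₁
        (proj₁ (path Q)) (AllPairs.tail (proj₁ (proj₂ (path Q)))) w∈'
      open Splice sp hiding (chain₁)
      in-P : ∀ {e} → e ∈ₗ edgesOf G (d ∷ ds₁) → e ∈ₗ edgesOf G (ds P)
      in-P e∈ = ∈≡ (cong (edgesOf G) (sym eq))
        (∈≡ (sym (map-++ proj₁ (d ∷ ds₁) ds₂)) (∈-++⁺ˡ e∈))
      fresh : ∀ {z} → z ∈ₗ map tG (d₁ ∷ darts) → a P ≢ z
      fresh z∈ refl with target⇒′ z∈
      ... | inj₁ z∈p = All.lookup unram₁ z∈p (ramA P)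
      ... | inj₂ z∈q = [ (λ ¬r → ¬r (ramA P)) , a≢ ]′ (adm-targets Q z∈q)
      simple : IsSimple (a P) (d₁ ∷ darts)
      simple = All.tabulate fresh ∷ distinct
      R : AdmPath
      R = record
        { a = a P ; b = b Q ; ds = d₁ ∷ darts ; ramA = ramA P ; ramB = ramB Q ; a≢b = a≢
        ; path = chain , simple , simple⇒uniqueEdges chain simple
        ; inter = All.tabulate λ z∈ → [ All.lookup unram₁ , All.lookup (inter Q) ]′ (interior⇒ z∈) }

    -- If `P` starts where `Q` ends, the spliced route would close up. Then `Q` is reversed first,
    -- which keeps it in its class because a path shares its edges with its reverse.
    meet2 : ∀ P Q {w} → Unram w → w ∈ₗ a P ∷ map tG (ds P) → w ∈ₗ a Q ∷ map tG (ds Q) → Star Step2 P Q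
    meet2 P Q ¬rw (here refl) _           = ⊥-elim (¬rw (ramA P))
    meet2 P Q ¬rw (there _)   (here refl) = ⊥-elim (¬rw (ramA Q))
    meet2 P Q {w} ¬rw (there w∈) (there w∈') with a P ≟ b Q
    ... | no a≢ = link P Q a≢ ¬rw w∈ w∈'
    ... | yes a≡ = link P (reverse-adm Q) (λ eq → a≢b Q (trans (sym eq) a≡)) ¬rw w∈ (in-rev Q w∈')
      ◅◅ (Step2-reverse Q ◅ ε)
      where
      in-rev : ∀ Q → w ∈ₗ map tG (ds Q) → w ∈ₗ map tG (rev (ds Q))
      in-rev Q w∈ with target⇒origin (proj₁ (path Q)) w∈
      ... | inj₁ refl = ⊥-elim (¬rw (ramB Q))
      ... | inj₂ (d , d∈ , refl) = subst (_∈ₗ _) (t-flip d) (∈-map⁺ tG (∈rev d∈))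

    cp-targets : ∀ C {z} → z ∈ₗ map tG (cpDarts C) → (Unram z × ¬ VertexIn2Seg z) ⊎ z ≡ v C
    cp-targets C z∈ = [ inj₁ ∘ All.lookup (cinter C) , inj₂ ]′ (target⇒ (cchain C) z∈)

    cp-vertex : ∀ C {z} → z ∈ₗ v C ∷ map tG (cpDarts C) → (Unram z × ¬ VertexIn2Seg z) ⊎ z ≡ v C
    cp-vertex C (here eq)  = inj₂ eq
    cp-vertex C (there z∈) = cp-targets C z∈

    cp-distinct : ∀ C → Unique (map tG (cpDarts C))
    cp-distinct C = subst Unique (sym (interior-snoc (cchain C)))
      (Uniqueₚ.++⁺ (uniqV C) ([] ∷ []) λ { (z∈ , here refl) → proj₁ (All.lookup (cinter C) z∈) (ramV C) })

    -- With different base vertices, the spliced route would be an admissible path through an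
    -- interior vertex of `D`, which lies in no 2-segment. With equal bases and no common edge it is
    -- a closed path sharing an edge with both. A common edge is treated separately, because
    -- distinct targets alone do not make the edges of a closed path distinct.
    meet1 : ∀ C D {w} → Unram w → w ∈ₗ v C ∷ map tG (cpDarts C) → w ∈ₗ v D ∷ map tG (cpDarts D) → Star Step1 C D
    meet1 C D ¬rw (here refl) _           = ⊥-elim (¬rw (ramV C))
    meet1 C D ¬rw (there _)   (here refl) = ⊥-elim (¬rw (ramV D))
    meet1 C D {w} ¬rw (there w∈) (there w∈') with split-at (cchain C) w∈
    ... | d , ds₁ , ds₂ , eq , c₁ , c₂ = decide (v C ≟ v D) (Any.any? (_∈ₑ? edgesOf G (cpDarts D)) (edgesOf G (cpDarts C)))
      where
      good : All (λ z → Unram z × ¬ VertexIn2Seg z) (map tG (d ∷ ds₁))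
      good = interior-targets (d ∷ ds₁) (λ { refl → ¬rw (ramV C) }) c₂
        (subst (λ l → All (λ z → Unram z × ¬ VertexIn2Seg z) (interior G l)) eq (cinter C))
      distinctC : Unique (map tG (d ∷ ds₁) ++ map tG ds₂)
      distinctC = subst Unique (map-++ tG (d ∷ ds₁) ds₂) (subst (λ l → Unique (map tG l)) eq (cp-distinct C))
      sp : Splice (v C) (d ∷ ds₁) (cpDarts D) (v D)
      sp = splice (ramV C) ¬rw (ramV D) c₁ (proj₁ (unique-++⁻ _ distinctC)) (All.map proj₁ good)
        (cchain D) (cp-distinct D) w∈'
      open Splice sp hiding (chain₁)
      decide : Dec (v C ≡ v D) → Dec (Any.Any (_∈ₗ edgesOf G (cpDarts D)) (edgesOf G (cpDarts C))) → Star Step1 C D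
      decide (no v≢) _ = ⊥-elim ([ (λ (_ , ¬2seg) → ¬2seg (R , there x∈R)) , (λ x≡ → unram-x (subst Ram (sym x≡) (ramV D))) ]′ (cp-targets D x∈q))
        where
        fresh : ∀ {z} → z ∈ₗ map tG (d₁ ∷ darts) → v C ≢ z
        fresh z∈ refl with target⇒′ z∈
        ... | inj₁ z∈p = proj₁ (All.lookup good z∈p) (ramV C)
        ... | inj₂ z∈q = [ (λ (¬r , _) → ¬r (ramV C)) , v≢ ]′ (cp-targets D z∈q)
        simple : IsSimple (v C) (d₁ ∷ darts)
        simple = All.tabulate fresh ∷ distinct
        R : AdmPath
        R = record
          { a = v C ; b = v D ; ds = d₁ ∷ darts ; ramA = ramV C ; ramB = ramV D ; a≢b = v≢
          ; path = chain , simple , simple⇒uniqueEdges chain simple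
          ; inter = All.tabulate λ z∈ → [ proj₁ ∘ All.lookup good , proj₁ ∘ All.lookup (cinter D) ]′ (interior⇒ z∈) }
        x∈R : x ∈ₗ map tG (d₁ ∷ darts)
        x∈R = ∈≡ (sym (map-++ tG (d₁ ∷ p₁) (d₂ ∷ q₂))) (∈-++⁺ˡ (end∈ (Splice.chain₁ sp)))
      decide (yes v≡) (yes share) = let e , e∈ , e∈' = find share in (v≡ , e , e∈ , e∈') ◅ ε
      decide (yes v≡) (no ¬share) =
        _◅_ {j = R} (refl , proj₁ d₁ , in-C edge₁ , here refl) ((v≡ , proj₁ d₂ , edge₂∈ , edge₂) ◅ ε)
        where
        in-C : ∀ {e} → e ∈ₗ edgesOf G (d ∷ ds₁) → e ∈ₗ edgesOf G (cpDarts C)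
        in-C e∈ = ∈≡ (cong (edgesOf G) (sym eq))
          (∈≡ (sym (map-++ proj₁ (d ∷ ds₁) ds₂)) (∈-++⁺ˡ e∈))
        edges₁ : edgesOf G (cpDarts C) ≡ edgesOf G (d₁ ∷ p₁) ++ edgesOf G (p₂ ++ ds₂)
        edges₁ = trans (cong (edgesOf G) (trans eq (trans (cong (_++ ds₂) p≡) (++-assoc (d₁ ∷ p₁) p₂ ds₂))))
          (map-++ proj₁ (d₁ ∷ p₁) (p₂ ++ ds₂))
        edges₂ : edgesOf G (cpDarts D) ≡ edgesOf G q₁ ++ edgesOf G (d₂ ∷ q₂)
        edges₂ = trans (cong (edgesOf G) q≡) (map-++ proj₁ q₁ (d₂ ∷ q₂))
        R : ClosedPath
        R = record
          { v = v C ; ramV = ramV C ; d = d₁ ; ds' = darts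
          ; chain = subst (Chain G (v C) (d₁ ∷ darts)) (sym v≡) chain
          ; uniqE = subst Unique (sym (map-++ proj₁ (d₁ ∷ p₁) (d₂ ∷ q₂))) (Uniqueₚ.++⁺
              (proj₁ (unique-++⁻ (edgesOf G (d₁ ∷ p₁)) (subst Unique edges₁ (uniqE C))))
              (proj₁ (proj₂ (unique-++⁻ (edgesOf G q₁) (subst Unique edges₂ (uniqE D)))))
              λ (e∈ , e∈') → ¬share (lose (∈≡ (sym edges₁) (∈-++⁺ˡ e∈))
                (∈≡ (sym edges₂) (∈-++⁺ʳ (edgesOf G q₁) e∈'))))
          ; uniqV = proj₁ (unique-++⁻ _ (subst Unique (interior-snoc chain) distinct))
          ; inter = All.tabulate λ z∈ → [ All.lookup good , All.lookup (cinter D) ]′ (interior⇒ z∈) }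

    vertex2 : ∀ Q {e w} → e ∈ₗ edgesOf G (ds Q) → Incident e w → w ∈ₗ a Q ∷ map tG (ds Q)
    vertex2 Q = incident∈ (proj₁ (path Q))

    vertex1 : ∀ D {e w} → e ∈ₗ edgesOf G (cpDarts D) → Incident e w → w ∈ₗ v D ∷ map tG (cpDarts D)
    vertex1 D = incident∈ (cchain D)

    not-both : ∀ Q D {e e' w} → Unram w → e ∈ₗ edgesOf G (ds Q) → Incident e w →
      e' ∈ₗ edgesOf G (cpDarts D) → Incident e' w → ⊥
    not-both Q D ¬rw e∈ inc e'∈ inc' with cp-vertex D (vertex1 D e'∈ inc')
    ... | inj₁ (_ , ¬2seg) = ¬2seg (Q , vertex2 Q e∈ inc)
    ... | inj₂ refl        = ¬rw (ramV D)

    private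
      Is2 : AdmPath → Subset nE → Set
      Is2 P S = ∀ e → (e ∈ S) ⇔ (∃[ Q ] (Star Step2 P Q × e ∈ₗ edgesOf G (ds Q)))
      Is1 : ClosedPath → Subset nE → Set
      Is1 C S = ∀ e → (e ∈ S) ⇔ (∃[ D ] (Star Step1 C D × e ∈ₗ edgesOf G (cpDarts D)))

      class2 : ∀ {P P' S S'} → Is2 P S → Is2 P' S' → Star Step2 P P' → S ≡ S'
      class2 h h' P~P' = ⊆-antisym
        (λ {e} e∈ → let Q , P~Q , e∈Q = to (h e) e∈ in from (h' e) (Q , star2-sym P~P' ◅◅ P~Q , e∈Q))
        (λ {e} e∈ → let Q , P~Q , e∈Q = to (h' e) e∈ in from (h e) (Q , P~P' ◅◅ P~Q , e∈Q))

      class1 : ∀ {C C' S S'} → Is1 C S → Is1 C' S' → Star Step1 C C' → S ≡ S'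
      class1 h h' C~C' = ⊆-antisym
        (λ {e} e∈ → let D , C~D , e∈D = to (h e) e∈ in from (h' e) (D , star1-sym C~C' ◅◅ C~D , e∈D))
        (λ {e} e∈ → let D , C~D , e∈D = to (h' e) e∈ in from (h e) (D , C~C' ◅◅ C~D , e∈D))

    segment-vertex-unique : ∀ {S S' e e' w} → IsSegment S → IsSegment S' → Unram w →
      e ∈ S → Incident e w → e' ∈ S' → Incident e' w → S ≡ S'
    segment-vertex-unique {e = e} {e'} (inj₁ (P , h)) (inj₁ (P' , h')) ¬rw e∈ inc e'∈ inc'
      with to (h e) e∈ | to (h' e') e'∈
    ... | Q , P~Q , e∈Q | Q' , P'~Q' , e'∈Q' = class2 h h'
      (P~Q ◅◅ meet2 Q Q' ¬rw (vertex2 Q e∈Q inc) (vertex2 Q' e'∈Q' inc') ◅◅ star2-sym P'~Q')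
    segment-vertex-unique {e = e} {e'} (inj₂ (C , h)) (inj₂ (C' , h')) ¬rw e∈ inc e'∈ inc'
      with to (h e) e∈ | to (h' e') e'∈
    ... | D , C~D , e∈D | D' , C'~D' , e'∈D' = class1 h h'
      (C~D ◅◅ meet1 D D' ¬rw (vertex1 D e∈D inc) (vertex1 D' e'∈D' inc') ◅◅ star1-sym C'~D')
    segment-vertex-unique {e = e} {e'} (inj₁ (P , h)) (inj₂ (C , h')) ¬rw e∈ inc e'∈ inc' =
      let Q , _ , e∈Q = to (h e) e∈ ; D , _ , e'∈D = to (h' e') e'∈
      in ⊥-elim (not-both Q D ¬rw e∈Q inc e'∈D inc')
    segment-vertex-unique {e = e} {e'} (inj₂ (C , h)) (inj₁ (P , h')) ¬rw e∈ inc e'∈ inc' =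
      let D , _ , e∈D = to (h e) e∈ ; Q , _ , e'∈Q = to (h' e') e'∈
      in ⊥-elim (not-both Q D ¬rw e'∈Q inc' e∈D inc)

    ramified-loop : ∀ D {e w} → Ram w → e ∈ₗ edgesOf G (cpDarts D) → Incident e w → w ≡ v D
    ramified-loop D rw e∈ inc = [ (λ (¬r , _) → ⊥-elim (¬r rw)) , id ]′ (cp-vertex D (vertex1 D e∈ inc))

    no-loop : ∀ Q {e} → e ∈ₗ edgesOf G (ds Q) → src e ≢ tgt e
    no-loop Q e∈ with ∈-map⁻ proj₁ e∈
    ... | d , d∈ , refl = go d (proj₁ (path Q)) (proj₁ (proj₂ (path Q))) d∈
      where
      go : ∀ {u w ds} d → Chain G u ds w → IsSimple u ds → d ∈ₗ ds → src (proj₁ d) ≢ tgt (proj₁ d)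
      go (_ , true)  (cons _ _ refl _) ((o≢ ∷ _) ∷ _) (here refl) eq = o≢ eq
      go (_ , false) (cons _ _ refl _) ((o≢ ∷ _) ∷ _) (here refl) eq = o≢ (sym eq)
      go d (cons _ _ _ c) (_ ∷ s) (there d∈) eq = go d c s d∈ eq

    -- An unramified end reduces the claim to `segment-vertex-unique`. With both ends ramified, two
    -- paths through `e` are one step apart when they are of the same kind. Different kinds cannot
    -- occur: in a closed path such an edge is a loop at the base, and an admissible path contains
    -- no loop.
    segment-edge-unique : ∀ {S S' e} → IsSegment S → IsSegment S' → e ∈ S → e ∈ S' → S ≡ S'
    segment-edge-unique {e = e} seg seg' e∈ e∈' with ram? (src e) | ram? (tgt e)
    ... | no ¬r | _ = segment-vertex-unique seg seg' ¬r e∈ (inj₁ refl) e∈' (inj₁ refl)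
    ... | _ | no ¬r = segment-vertex-unique seg seg' ¬r e∈ (inj₂ refl) e∈' (inj₂ refl)
    segment-edge-unique {e = e} (inj₁ (P , h)) (inj₁ (P' , h')) e∈ e∈' | yes _ | yes _ =
      let Q , P~Q , e∈Q = to (h e) e∈ ; Q' , P'~Q' , e∈Q' = to (h' e) e∈'
      in class2 h h' (P~Q ◅◅ step2 Q Q' e∈Q e∈Q' ◅ star2-sym P'~Q')
    segment-edge-unique {e = e} (inj₂ (C , h)) (inj₂ (C' , h')) e∈ e∈' | yes r | yes _ =
      let D , C~D , e∈D = to (h e) e∈ ; D' , C'~D' , e∈D' = to (h' e) e∈'
          step = trans (sym (ramified-loop D r e∈D (inj₁ refl))) (ramified-loop D' r e∈D' (inj₁ refl)) ,
                 e , e∈D , e∈D'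
      in class1 h h' (C~D ◅◅ step ◅ star1-sym C'~D')
    segment-edge-unique {e = e} (inj₁ (P , h)) (inj₂ (C , h')) e∈ e∈' | yes r | yes r' =
      let Q , _ , e∈Q = to (h e) e∈ ; D , _ , e∈D = to (h' e) e∈'
      in ⊥-elim (no-loop Q e∈Q (trans (ramified-loop D r e∈D (inj₁ refl)) (sym (ramified-loop D r' e∈D (inj₂ refl)))))
    segment-edge-unique {e = e} (inj₂ (C , h)) (inj₁ (P , h')) e∈ e∈' | yes r | yes r' =
      let Q , _ , e∈Q = to (h' e) e∈' ; D , _ , e∈D = to (h e) e∈
      in ⊥-elim (no-loop Q e∈Q (trans (ramified-loop D r e∈D (inj₁ refl)) (sym (ramified-loop D r' e∈D (inj₂ refl)))))

    class-ends : ∀ {P Q} → Star Step2 P Q → ∀ {m} → m ≡ a Q ⊎ m ≡ b Q → m ≡ a P ⊎ m ≡ b P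
    class-ends ε = id
    class-ends {P} (_◅_ {j = Q} (same , _) rest) m∈ = pull {P} {Q} same (class-ends rest m∈)
      where
      pull : ∀ {P Q} → SamePair P Q → ∀ {m} → m ≡ a Q ⊎ m ≡ b Q → m ≡ a P ⊎ m ≡ b P
      pull (inj₁ (p , q)) (inj₁ m≡) = inj₁ (trans m≡ (sym p))
      pull (inj₁ (p , q)) (inj₂ m≡) = inj₂ (trans m≡ (sym q))
      pull (inj₂ (p , q)) (inj₁ m≡) = inj₂ (trans m≡ (sym q))
      pull (inj₂ (p , q)) (inj₂ m≡) = inj₁ (trans m≡ (sym p))

    class-base : ∀ {C D} → Star Step1 C D → v D ≡ v C
    class-base ε                   = refl
    class-base ((same , _) ◅ rest) = trans (class-base rest) (sym same)

    segment-ends : ∀ {S} → IsSegment S → ∃[ x ] ∃[ y ] (SegMarked S x × SegMarked S y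
      × (∀ {m} → SegMarked S m → m ≡ x ⊎ m ≡ y))
    segment-ends {S} (inj₁ (P , h)) = a P , b P , (first (proj₁ (path P)) id , ramA P) ,
      (last (proj₁ (path P)) id , ramB P) , marked
      where
      in-S : ∀ {d} → d ∈ₗ ds P → proj₁ d ∈ S
      in-S d∈ = from (h _) (P , ε , ∈-map⁺ proj₁ d∈)
      first : ∀ {ds'} → Chain G (a P) ds' (b P) → (∀ {d} → d ∈ₗ ds' → d ∈ₗ ds P) → SegVertex S (a P)
      first nil _ = ⊥-elim (a≢b P refl)
      first (cons d _ eq _) sub = proj₁ d , in-S (sub (here refl)) , subst (Incident (proj₁ d)) eq (incident-o d)
      last : ∀ {ds'} → Chain G (a P) ds' (b P) → (∀ {d} → d ∈ₗ ds' → d ∈ₗ ds P) → SegVertex S (b P)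
      last nil _ = ⊥-elim (a≢b P refl)
      last c@(cons _ _ _ _) sub with ∈-map⁻ tG (end∈ c)
      ... | d , d∈ , eq = proj₁ d , in-S (sub d∈) , subst (Incident (proj₁ d)) (sym eq) (incident-t d)
      marked : ∀ {m} → SegMarked S m → m ≡ a P ⊎ m ≡ b P
      marked ((e , e∈ , inc) , rm) = let Q , P~Q , e∈Q = to (h e) e∈
        in class-ends P~Q (adm-vertex Q (vertex2 Q e∈Q inc) rm)
    segment-ends {S} (inj₂ (C , h)) = v C , v C , (base , ramV C) , (base , ramV C) , marked
      where
      base : SegVertex S (v C)
      base with cchain C
      ... | cons d _ eq _ = proj₁ d , from (h _) (C , ε , here refl) , subst (Incident (proj₁ d)) eq (incident-o d)
      marked : ∀ {m} → SegMarked S m → m ≡ v C ⊎ m ≡ v C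
      marked ((e , e∈ , inc) , rm) = let D , C~D , e∈D = to (h e) e∈
        in inj₁ (trans (ramified-loop D rm e∈D inc) (class-base C~D))

    -- The class of a path quantifies over all sequences of paths and is not decided here, so
    -- excluded middle is used, for finitely many edges, under a double negation. Membership of `e`
    -- in one of finitely many listed segments is decidable, so the double negation can be removed
    -- later.
    segment-cover : ∀ e → ¬ ¬ (∃[ S ] (IsSegment S × e ∈ S))
    segment-cover e k = ¬¬-excluded-middle {A = EdgeIn2Seg e} λ
      { (yes (P , e∈P)) → ¬¬-∀ (λ _ → ¬¬-excluded-middle) λ dec →
          let S , h = comprehension dec in k (S , inj₁ (P , h) , from (h e) (P , ε , e∈P))
      ; (no ¬2seg) → let C , e∈C = proj₂ decomp e ¬2seg in
          ¬¬-∀ (λ _ → ¬¬-excluded-middle) λ dec →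
          let S , h = comprehension dec in k (S , inj₂ (C , h) , from (h e) (C , ε , e∈C)) }

-- Lists, sums and products for the tower.

unique-concatMap : {A B : Set} {f : A → List B} {xs : List A} → (∀ x → Unique (f x)) →
  (∀ {x y} → x ≢ y → Disjoint (f x) (f y)) → Unique xs → Unique (concatMap f xs)
unique-concatMap uf disj ux = Uniqueₚ.concat⁺ (Allₚ.map⁺ (All.universal uf _))
  (AllPairsₚ.map⁺ (AllPairs.map disj ux))

length-concatMap : {A B : Set} (f : A → List B) (xs : List A) →
  length (concatMap f xs) ≡ sum (map (length ∘ f) xs)
length-concatMap f []       = refl
length-concatMap f (x ∷ xs) = trans (length-++ (f x)) (cong (length (f x) +_) (length-concatMap f xs))

map-constant : {A B : Set} {f : A → B} {c : B} (xs : List A) → (∀ x → f x ≡ c) →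
  map f xs ≡ replicate (length xs) c
map-constant []       h = refl
map-constant (x ∷ xs) h = cong₂ _∷_ (h x) (map-constant xs h)

map-cartesianProduct : {A B C : Set} {h : A × B → C} {h' : A → C} (xs : List A) (ys : List B) →
  (∀ x y → h (x , y) ≡ h' x) →
  map h (cartesianProduct xs ys) ≡ concatMap (replicate (length ys)) (map h' xs)
map-cartesianProduct []       ys eq = refl
map-cartesianProduct {h = h} (x ∷ xs) ys eq = trans (map-++ h (map (x ,_) ys) _)
  (cong₂ _++_ (trans (sym (map-∘ ys)) (map-constant ys (eq x))) (map-cartesianProduct xs ys eq))

product-concatMap-replicate : ∀ k xs → product (concatMap (replicate k) xs) ≡ product (map (_^ k) xs)
product-concatMap-replicate k []       = refl
product-concatMap-replicate k (x ∷ xs) = trans (product-++ (replicate k x) _)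
  (cong₂ _*_ (power k) (product-concatMap-replicate k xs))
  where
  power : ∀ k → product (replicate k x) ≡ x ^ k
  power zero    = refl
  power (suc k) = cong (x *_) (power k)

sum-map-mono : {A : Set} {f g : A → ℕ} (xs : List A) → (∀ x → f x ≤ g x) → sum (map f xs) ≤ sum (map g xs)
sum-map-mono []       h = z≤n
sum-map-mono (x ∷ xs) h = +-mono-≤ (h x) (sum-map-mono xs h)

sum-map-≡ : {A : Set} {f g : A → ℕ} {xs : List A} → (∀ x → f x ≤ g x) →
  sum (map f xs) ≡ sum (map g xs) → ∀ {x} → x ∈ₗ xs → f x ≡ g x
sum-map-≡ {f = f} {g} {y ∷ ys} h eq = λ
  { (here refl) → head
  ; (there x∈) → sum-map-≡ h (+-cancelˡ-≡ (f y) _ _ (trans eq (cong (_+ sum (map g ys)) (sym head)))) x∈ }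
  where
  head : f y ≡ g y
  head = ≤-antisym (h y) (≮⇒≥ λ f<g → <-irrefl eq (+-mono-<-≤ f<g (sum-map-mono ys h)))

lookup-unique-injective : {A : Set} {xs : List A} → Unique xs → ∀ {i j} → lookup xs i ≡ lookup xs j → i ≡ j
lookup-unique-injective (x∉ ∷ u) {zero}  {zero}  eq = refl
lookup-unique-injective (x∉ ∷ u) {zero}  {suc j} eq = ⊥-elim (All.lookup x∉ (∈-lookup j) eq)
lookup-unique-injective (x∉ ∷ u) {suc i} {zero}  eq = ⊥-elim (All.lookup x∉ (∈-lookup i) (sym eq))
lookup-unique-injective (x∉ ∷ u) {suc i} {suc j} eq = cong suc (lookup-unique-injective u eq)

pointwise⇒tabulate : {A B : Set} {R : A → B → Set} {xs : List A} {ys : List B} → Pointwise R xs ys →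
  ∃[ f ] (tabulate f ≡ ys × (∀ i → R (lookup xs i) (f i)))
pointwise⇒tabulate [] = (λ ()) , refl , λ ()
pointwise⇒tabulate (_∷_ {y = y} r rs) with pointwise⇒tabulate rs
... | f , refl , h = (λ { zero → y ; (suc i) → f i }) , refl , λ { zero → r ; (suc i) → h i }

module _ {W : Set} {_≟_ : DecidableEquality W} where
  open Blocks _≟_
  open Block

  allVertices⁻ : ∀ {R x} Bs → x ∈ₗ allVertices R Bs → x ∈ₗ R ⊎ ∃[ B ] (B ∈ₗ Bs × x ∈ₗ inner B)
  allVertices⁻ []       x∈ = inj₁ x∈
  allVertices⁻ (B ∷ Bs) x∈ with ∈-++⁻ (inner B) x∈
  ... | inj₁ x∈B = inj₂ (B , here refl , x∈B)
  ... | inj₂ x∈' with allVertices⁻ Bs x∈'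
  ...   | inj₁ x∈R              = inj₁ x∈R
  ...   | inj₂ (B' , B'∈ , x∈B') = inj₂ (B' , there B'∈ , x∈B')

  allVertices⁺ : ∀ {R x B Bs} → B ∈ₗ Bs → x ∈ₗ inner B → x ∈ₗ allVertices R Bs
  allVertices⁺ (here refl)              x∈ = ∈-++⁺ˡ x∈
  allVertices⁺ {Bs = B' ∷ Bs} (there B∈) x∈ = ∈-++⁺ʳ (inner B') (allVertices⁺ B∈ x∈)

  wellFormed : ∀ {R Bs} →
    All (λ B → fst B ∈ₗ R × snd B ∈ₗ R × All (_Within vertices B) (edges B) × Disjoint (inner B) R) Bs →
    AllPairs (λ B B' → Disjoint (inner B) (inner B')) Bs → WellFormed R Bs
  wellFormed [] [] = []
  wellFormed {Bs = B ∷ Bs} ((a∈ , b∈ , es∈ , disjR) ∷ hs) (disj ∷ disjs) = cons a∈ b∈ es∈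
    (λ x∈ x∈' → [ (λ x∈R → disjR (x∈ , x∈R))
                , (λ (B' , B'∈ , x∈B') → All.lookup disj B'∈ (x∈ , x∈B')) ]′ (allVertices⁻ Bs x∈'))
    (wellFormed hs disjs)

toℕ-mod : ∀ g {d d'} .{{_ : NonZero d}} .{{_ : NonZero d'}} → d ≡ d' → toℕ (g mod d) ≡ g % d'
toℕ-mod g refl = toℕ-fromℕ< _

-- The tower

module TowerCount (p : ℕ) (pp : Prime p) (V E : ℕ) (s r : Fin E → Fin V) (I : Fin V → Maybe ℕ) where

  G : Graph
  G = baseGraph V E s r

  open Tower p pp V E s r I
  open Marked G Ram

  W : Set
  W = Fin V × ℕ

  _≟W_ : DecidableEquality W
  _≟W_ = ≡-dec Fin._≟_ ℕ._≟_

  ram? : ∀ v → Dec (Ram v)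
  ram? v with I v
  ... | nothing = no λ h → h refl
  ... | just _  = yes λ ()

  module _ {v : Fin V} where

    unram⇒nothing : Unram v → I v ≡ nothing
    unram⇒nothing h with I v
    ... | nothing = refl
    ... | just _  = ⊥-elim (h λ ())

    ram⇒just : Ram v → ∃[ m ] I v ≡ just m
    ram⇒just h with I v
    ... | nothing = ⊥-elim (h refl)
    ... | just m  = m , refl

    fibre-nothing : ∀ n → I v ≡ nothing → fibre v n ≡ p ^ n
    fibre-nothing n eq rewrite eq = refl

    fibre-just : ∀ n {m} → I v ≡ just m → fibre v n ≡ p ^ (m ⊓ n)
    fibre-just n eq rewrite eq = refl

  -- The quotient map to the fibre over `v` once ramified fibres have reached their final size. It
  -- does not mention the level, so different levels can be compared inside `W`.
  red : Fin V → ℕ → ℕ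
  red v g with I v
  ... | nothing = g
  ... | just m  = _%_ g (p ^ m) {{m^n≢0 p m}}

  red-unram : ∀ {v} g → Unram v → red v g ≡ g
  red-unram {v} g h with I v
  ... | nothing = refl
  ... | just _  = ⊥-elim (h λ ())

  φ : ℕ → Fin V → W
  φ g v = v , red v g

  ramFibre : Fin V → List W
  ramFibre v with I v
  ... | nothing = []
  ... | just m  = map (v ,_) (upTo (p ^ m))

  ramFibre⁺ : ∀ {v m i} → I v ≡ just m → i < p ^ m → (v , i) ∈ₗ ramFibre v
  ramFibre⁺ {v} eq i< rewrite eq = ∈-map⁺ (v ,_) (∈-upTo⁺ i<)

  ramFibre⁻ : ∀ {v x} → x ∈ₗ ramFibre v → proj₁ x ≡ v × ∃[ m ] (I v ≡ just m × proj₂ x < p ^ m)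
  ramFibre⁻ {v} x∈ with I v
  ... | just m with ∈-map⁻ (v ,_) x∈
  ...   | i , i∈ , refl = refl , m , refl , ∈-upTo⁻ i∈

  R : List W
  R = concatMap ramFibre (allFin V)

  R⁺ : ∀ {v m i} → I v ≡ just m → i < p ^ m → (v , i) ∈ₗ R
  R⁺ {v} eq i< = ∈-concatMap⁺ ramFibre (lose (∈-allFin v) (ramFibre⁺ eq i<))

  R⁻ : ∀ {v i} → (v , i) ∈ₗ R → ∃[ m ] (I v ≡ just m × i < p ^ m)
  R⁻ x∈ with find (∈-concatMap⁻ ramFibre {xs = allFin V} x∈)
  ... | v , _ , x∈v with ramFibre⁻ x∈v
  ...   | refl , h = h

  R-unique : Unique R
  R-unique = unique-concatMap unique-fibre
    (λ v≢v' (x∈ , x∈') → v≢v' (trans (sym (proj₁ (ramFibre⁻ x∈))) (proj₁ (ramFibre⁻ x∈'))))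
    (Uniqueₚ.allFin⁺ V)
    where
    unique-fibre : ∀ v → Unique (ramFibre v)
    unique-fibre v with I v
    ... | nothing = []
    ... | just m  = Uniqueₚ.map⁺ (λ { refl → refl }) (Uniqueₚ.upTo⁺ (p ^ m))

  φ∈R : ∀ {v} g → Ram v → φ g v ∈ₗ R
  φ∈R {v} g h with ram⇒just h
  ... | m , eq = R⁺ eq (subst (_< p ^ m) (sym (red-just eq)) (m%n<n g (p ^ m) {{m^n≢0 p m}}))
    where
    red-just : I v ≡ just m → red v g ≡ _%_ g (p ^ m) {{m^n≢0 p m}}
    red-just eq rewrite eq = refl

  -- All ramified fibres have their final size at level `n`: there `p ^ (m ⊓ n)` is `p ^ m`.
  Bounded : ℕ → Set
  Bounded n = ∀ v {m} → I v ≡ just m → m ≤ n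

  -- No ramified fibre shrinks with the level, so equal sums force equal fibres; but a fibre with
  -- `n < m` still grows from `p ^ n` to `p ^ suc n`.
  stable⇒bounded : ∀ n → ramifiedCount n ≡ ramifiedCount (suc n) → Bounded n
  stable⇒bounded n eq v {m} Iv = ≮⇒≥ λ n<m → <-irrefl (same n<m) (^-monoʳ-< p 1<p (n<1+n n))
    where
    instance _ = prime⇒nonTrivial pp
    1<p : 1 < p
    1<p = ℕ.nonTrivial⇒n>1 p
    size : ℕ → Fin V → ℕ
    size k v = if is-just (I v) then fibre v k else 0
    mono : ∀ v → size n v ≤ size (suc n) v
    mono v with I v
    ... | nothing = z≤n
    ... | just m  = ^-monoʳ-≤ p (⊓-monoʳ-≤ m (n≤1+n n))
    size-just : ∀ k → size k v ≡ p ^ (m ⊓ k)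
    size-just k rewrite Iv = refl
    same : n < m → p ^ n ≡ p ^ suc n
    same n<m = trans (cong (p ^_) (sym (m≥n⇒m⊓n≡n (<⇒≤ n<m))))
      (trans (trans (sym (size-just n)) (trans (sum-map-≡ {xs = allFin V} mono eq (∈-allFin v)) (size-just (suc n))))
        (cong (p ^_) (m≥n⇒m⊓n≡n n<m)))

  length-R : ∀ n → Bounded n → length R ≡ ramifiedCount n
  length-R n bounded = trans (length-concatMap ramFibre (allFin V)) (cong sum (map-cong len (allFin V)))
    where
    len : ∀ v → length (ramFibre v) ≡ (if is-just (I v) then fibre v n else 0)
    len v with I v | bounded v
    ... | nothing | _ = refl
    ... | just m  | b = trans (length-map _ (upTo (p ^ m))) (trans (length-upTo (p ^ m))
      (cong (p ^_) (sym (m≤n⇒m⊓n≡m (b refl)))))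

  ι : ∀ n → Graph.Vtx (X n) → W
  ι n (v , i) = v , toℕ i

  ι-injective : ∀ n {u w} → ι n u ≡ ι n w → u ≡ w
  ι-injective n {v , i} {v' , i'} eq with ,-injective eq
  ... | refl , eq' = cong (v ,_) (toℕ-injective eq')

  reduce-red : ∀ n → Bounded n → ∀ v g → toℕ (reduce v n g) ≡ red v (toℕ g)
  reduce-red n bounded v g with I v | bounded v
  ... | nothing | _ = refl
  ... | just m  | b = toℕ-mod (toℕ g) {{m^n≢0 p (m ⊓ n)}} {{m^n≢0 p m}} (cong (p ^_) (m≤n⇒m⊓n≡m (b refl)))

  segVertex? : ∀ S w → Dec (SegVertex S w)
  segVertex? S w = anyFin? λ e → (e ∈? S) ×-dec ((s e Fin.≟ w) ⊎-dec (r e Fin.≟ w))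

  record SegmentStructure (k : ℕ) : Set where
    field
      S            : Fin k → Subset E
      F            : Fin k → ℕ
      a b          : Fin k → Fin V
      markedA      : ∀ i → SegMarked (S i) (a i)
      markedB      : ∀ i → SegMarked (S i) (b i)
      marked⇒      : ∀ i {m} → SegMarked (S i) m → m ≡ a i ⊎ m ≡ b i
      edgeCover    : ∀ e → ∃[ i ] e ∈ S i
      edgeUnique   : ∀ {e i j} → e ∈ S i → e ∈ S j → i ≡ j
      vertexCover  : ∀ {w} → Unram w → ∃[ i ] SegVertex (S i) w
      vertexUnique : ∀ {w i j} → Unram w → SegVertex (S i) w → SegVertex (S j) w → i ≡ j
      forests      : ∀ i → NumSegmentalForests (S i) (F i)

  module WithSegments {k : ℕ} (𝓢 : SegmentStructure k) (n₀ : ℕ) (bounded : Bounded n₀) where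

    open SegmentStructure 𝓢
    open Blocks _≟W_
    open Block
    module C = Count (Fin._≟_ {V})
    module GB = GraphCount G (Fin._≟_ {V}) id id

    J : Fin k → List (Fin V)
    J i = filter (λ w → ¬? (ram? w) ×-dec segVertex? (S i) w) (allFin V)

    J⁻ : ∀ {i w} → w ∈ₗ J i → Unram w × SegVertex (S i) w
    J⁻ {i} w∈ = proj₂ (∈-filter⁻ _ {xs = allFin V} w∈)

    J⁺ : ∀ {i w} → Unram w → SegVertex (S i) w → w ∈ₗ J i
    J⁺ {i} {w} ¬r sv = ∈-filter⁺ (λ w → ¬? (ram? w) ×-dec segVertex? (S i) w) (∈-allFin w) (¬r , sv)

    segEdges : Fin k → List (Fin E)
    segEdges i = filter (_∈? S i) (allFin E)

    segEdges⇔ : ∀ {i e} → e ∈ₗ segEdges i ⇔ e ∈ S i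
    segEdges⇔ {i} {e} = mk⇔ (proj₂ ∘ ∈-filter⁻ (_∈? S i) {xs = allFin E}) (∈-filter⁺ (_∈? S i) (∈-allFin e))

    segEdges-unique : ∀ i → Unique (segEdges i)
    segEdges-unique i = Uniqueₚ.filter⁺ (_∈? S i) (Uniqueₚ.allFin⁺ E)

    segVertices : Fin k → List (Fin V)
    segVertices i = a i ∷ b i ∷ J i

    segVertices⇔ : ∀ {i w} → w ∈ₗ segVertices i ⇔ SegVertex (S i) w
    segVertices⇔ {i} {w} = mk⇔ fwd bwd
      where
      fwd : w ∈ₗ segVertices i → SegVertex (S i) w
      fwd (here refl)         = proj₁ (markedA i)
      fwd (there (here refl)) = proj₁ (markedB i)
      fwd (there (there w∈))  = proj₂ (J⁻ w∈)
      bwd : SegVertex (S i) w → w ∈ₗ segVertices i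
      bwd sv with ram? w
      ... | no ¬r = there (there (J⁺ ¬r sv))
      ... | yes rw with marked⇒ i (sv , rw)
      ...   | inj₁ eq = here eq
      ...   | inj₂ eq = there (here eq)

    segPairs : Fin k → List (Fin V × Fin V)
    segPairs i = map GB.ends (segEdges i)

    K : Fin k → ℕ
    K i = C.N (segVertices i) [] (segPairs i)

    block : Fin k → ℕ → Block
    block i g = record
      { fst = φ g (a i) ; snd = φ g (b i) ; inner = map (φ g) (J i)
      ; edges = map (map² (φ g)) (segPairs i) }

    φ-injective : ∀ g {u w} → φ g u ≡ φ g w → u ≡ w
    φ-injective g eq = cong proj₁ eq

    block-toWEdge : ∀ i g → toWEdge (block i g) ≡ wedge (φ g (a i)) (φ g (b i)) (F i) (K i)
    block-toWEdge i g = cong₂ (wedge (φ g (a i)) (φ g (b i)))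
      (trans (N-map (φ g) (φ-injective g) Fin._≟_ _≟W_ (segVertices i) ((a i , b i) ∷ []) (segPairs i))
        (sym (SegmentCount.numSegmentalForests≡N G Fin._≟_ Ram (forests i) segVertices⇔
          (markedA i) (markedB i) (marked⇒ i) (segEdges-unique i) segEdges⇔)))
      (N-map (φ g) (φ-injective g) Fin._≟_ _≟W_ (segVertices i) [] (segPairs i))

    P : ℕ
    P = p ^ n₀

    -- The edges of the quotient multigraph on the ramified vertices at level n₀.
    quotientEdges : List WEdge
    quotientEdges = map (λ (i , g) → wedge (φ (toℕ g) (a i)) (φ (toℕ g) (b i)) (F i) (K i))
      (cartesianProduct (allFin k) (allFin P))

    product-cuts : ∀ c → product (map (λ e → WEdge.cut e ^ c) quotientEdges)
      ≡ product (map (λ f → f ^ (c * P)) (map F (allFin k)))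
    product-cuts c = begin
      product (map (λ e → WEdge.cut e ^ c) quotientEdges)
        ≡⟨ cong product (trans (sym (map-∘ (cartesianProduct (allFin k) (allFin P))))
             (map-cartesianProduct {h' = λ i → F i ^ c} (allFin k) (allFin P) λ _ _ → refl)) ⟩
      product (concatMap (replicate (length (allFin P))) (map (λ i → F i ^ c) (allFin k)))
        ≡⟨ product-concatMap-replicate (length (allFin P)) (map (λ i → F i ^ c) (allFin k)) ⟩
      product (map (_^ length (allFin P)) (map (λ i → F i ^ c) (allFin k)))
        ≡⟨ cong product (sym (map-∘ (allFin k))) ⟩
      product (map (λ i → (F i ^ c) ^ length (allFin P)) (allFin k))
        ≡⟨ cong product (map-cong (λ i → trans (cong ((F i ^ c) ^_) (length-tabulate {n = P} id))
             (^-*-assoc (F i) c P)) (allFin k)) ⟩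
      product (map (λ i → F i ^ (c * P)) (allFin k))
        ≡⟨ cong product (map-∘ (allFin k)) ⟩
      product (map (λ f → f ^ (c * P)) (map F (allFin k))) ∎
      where open ≡-Reasoning

    -- Here `p ^ m` divides `P`, so the ramified ends of a copy depend only on its index modulo `P`.
    -- This is why copies over higher levels become parallel edges of the quotient at level `n₀`.
    red-periodic : ∀ {v} → Ram v → ∀ j g → red v (P * j + g) ≡ red v g
    red-periodic {v} rv j g with I v | bounded v
    ... | nothing | _ = ⊥-elim (rv refl)
    ... | just m  | b = %-remove-+ˡ g {{m^n≢0 p m}} (∣m⇒∣m*n j (divides (p ^ (n₀ ∸ m))
      (trans (cong (p ^_) (sym (m∸n+n≡m (b refl)))) (^-distribˡ-+-* p (n₀ ∸ m) m))))

    module Level (n c : ℕ) (size : suc c * P ≡ p ^ n) (n₀≤n : n₀ ≤ n) where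

      bounded-n : Bounded n
      bounded-n v eq = ≤-trans (bounded v eq) n₀≤n

      -- The index `P * j + g`: the residue `g` modulo `P` selects a parallel class, and `j` numbers
      -- its `suc c` members.
      lift : Fin (suc c) → Fin P → Fin (p ^ n)
      lift j g = cast size (combine j g)

      toℕ-lift : ∀ j g → toℕ (lift j g) ≡ P * toℕ j + toℕ g
      toℕ-lift j g = trans (toℕ-cast size (combine j g)) (toℕ-combine j g)

      lift-injective : ∀ j g j' g' → lift j g ≡ lift j' g' → j ≡ j' × g ≡ g'
      lift-injective j g j' g' eq = combine-injective j g j' g' (toℕ-injective
        (trans (sym (toℕ-cast size _)) (trans (cong toℕ eq) (toℕ-cast size _))))

      lift-surjective : ∀ h → ∃[ j ] ∃[ g ] lift j g ≡ h
      lift-surjective h = let j , g = remQuot P (cast (sym size) h) in j , g ,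
        trans (cong (cast size) (combine-remQuot {suc c} P (cast (sym size) h))) (cast-involutive size (sym size) h)

      Index : Set
      Index = (Fin k × Fin P) × Fin (suc c)

      -- The coordinate `j` varies fastest, so that the members of a parallel class are consecutive,
      -- in the shape `concatMap (replicate (suc c))` that `Z-multiply` expects.
      indices : List Index
      indices = cartesianProduct (cartesianProduct (allFin k) (allFin P)) (allFin (suc c))

      indices-unique : Unique indices
      indices-unique = Uniqueₚ.cartesianProduct⁺
        (Uniqueₚ.cartesianProduct⁺ (Uniqueₚ.allFin⁺ k) (Uniqueₚ.allFin⁺ P)) (Uniqueₚ.allFin⁺ (suc c))

      ∈-indices : ∀ i g j → ((i , g) , j) ∈ₗ indices
      ∈-indices i g j = ∈-cartesianProduct⁺ (∈-cartesianProduct⁺ (∈-allFin i) (∈-allFin g)) (∈-allFin j)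

      blockAt : Index → Block
      blockAt ((i , g) , j) = block i (toℕ (lift j g))

      blocks : List Block
      blocks = map blockAt indices

      edgesAt : Index → List (Fin (E * p ^ n))
      edgesAt ((i , g) , j) = map (λ e → combine e (lift j g)) (segEdges i)

      edgesX : List (Fin (E * p ^ n))
      edgesX = concatMap edgesAt indices

      module GX = GraphCount (X n) _≟W_ (ι n) (ι-injective n)

      ends-combine : ∀ e h → GX.ends (combine e h) ≡ map² (φ (toℕ h)) (GB.ends e)
      ends-combine e h = trans (cong at (remQuot-combine {E} {p ^ n} e h)) (cong₂ _,_ (cong (s e ,_) (reduce-red n bounded-n (s e) h)) (cong (r e ,_) (reduce-red n bounded-n (r e) h)))
        where
        at : Fin E × Fin (p ^ n) → W × W
        at (e , h) = (s e , toℕ (reduce (s e) n h)) , (r e , toℕ (reduce (r e) n h))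

      ends-edgesX : map GX.ends edgesX ≡ concatMap edges blocks
      ends-edgesX = trans (map-concatMap GX.ends edgesAt indices)
        (trans (concatMap-cong at indices) (sym (concatMap-map edges blockAt indices)))
        where
        at : ∀ x → map GX.ends (edgesAt x) ≡ edges (blockAt x)
        at ((i , g) , j) = trans (sym (map-∘ (segEdges i)))
          (trans (map-cong (λ e → ends-combine e (lift j g)) (segEdges i)) (map-∘ (segEdges i)))

      edgesX-unique : Unique edgesX
      edgesX-unique = unique-concatMap
        (λ ((i , g) , j) → Uniqueₚ.map⁺ (λ {e} {e'} eq → proj₁ (combine-injective e _ e' _ eq)) (segEdges-unique i))
        (λ {x} {y} x≢y (z∈ , z∈') → x≢y (same x y z∈ z∈')) indices-unique
        where
        same : ∀ x y {z} → z ∈ₗ edgesAt x → z ∈ₗ edgesAt y → x ≡ y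
        same ((i , g) , j) ((i' , g') , j') z∈ z∈' with ∈-map⁻ _ z∈ | ∈-map⁻ _ z∈'
        ... | e , e∈ , refl | e' , e'∈ , eq with combine-injective e (lift j g) e' (lift j' g') eq
        ...   | refl , eq' with lift-injective j g j' g' eq' | edgeUnique (to segEdges⇔ e∈) (to segEdges⇔ e'∈)
        ...     | refl , refl | refl = refl

      edgesX-complete : ∀ z → z ∈ₗ edgesX
      edgesX-complete z = subst (_∈ₗ edgesX) (combine-remQuot {E} (p ^ n) z)
        (complete (proj₁ (remQuot {E} (p ^ n) z)) (proj₂ (remQuot {E} (p ^ n) z)))
        where
        complete : ∀ e h → combine e h ∈ₗ edgesX
        complete e h with lift-surjective h | edgeCover e
        ... | j , g , refl | i , e∈ = ∈-concatMap⁺ edgesAt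
          (lose (∈-indices i g j) (∈-map⁺ (λ e → combine e (lift j g)) (from segEdges⇔ e∈)))

      inner⁻ : ∀ {i h x} → x ∈ₗ inner (block i h) →
        Unram (proj₁ x) × SegVertex (S i) (proj₁ x) × proj₂ x ≡ h
      inner⁻ {i} {h} x∈ with ∈-map⁻ (φ h) x∈
      ... | w , w∈ , refl = let ¬r , sv = J⁻ w∈ in ¬r , sv , red-unram h ¬r

      blocks-wf : WellFormed R blocks
      blocks-wf = wellFormed
        (Allₚ.map⁺ (All.universal local indices))
        (AllPairsₚ.map⁺ (AllPairs.map (λ {x} {y} → disjoint x y) indices-unique))
        where
        local : ∀ x → let B = blockAt x in
          fst B ∈ₗ R × snd B ∈ₗ R × All (_Within vertices B) (edges B) × Disjoint (inner B) R
        local ((i , g) , j) = φ∈R h (proj₂ (markedA i)) , φ∈R h (proj₂ (markedB i)) ,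
          Allₚ.map⁺ (Allₚ.map⁺ (All.tabulate λ {e} e∈ →
            ∈-map⁺ (φ h) (from segVertices⇔ (e , to segEdges⇔ e∈ , inj₁ refl)) ,
            ∈-map⁺ (φ h) (from segVertices⇔ (e , to segEdges⇔ e∈ , inj₂ refl)))) ,
          λ (x∈ , x∈R) → let m , eq , _ = R⁻ x∈R in
            proj₁ (inner⁻ {i} x∈) λ eq' → just≢nothing (trans (sym eq) eq')
          where
          h = toℕ (lift j g)
          just≢nothing : ∀ {m : ℕ} → just m ≢ nothing
          just≢nothing ()
        same : ∀ x y {z} → z ∈ₗ inner (blockAt x) → z ∈ₗ inner (blockAt y) → x ≡ y
        same ((i , g) , j) ((i' , g') , j') z∈ z∈' with inner⁻ {i} z∈ | inner⁻ {i'} z∈'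
        ... | ¬r , sv , eq | _ , sv' , eq' with vertexUnique ¬r sv sv' | lift-injective j g j' g' (toℕ-injective (trans (sym eq) eq'))
        ...   | refl | refl , refl = refl
        disjoint : ∀ x y → x ≢ y → Disjoint (inner (blockAt x)) (inner (blockAt y))
        disjoint x y x≢y (z∈ , z∈') = x≢y (same x y z∈ z∈')

      vertex∈ : ∀ u → ι n u ∈ₗ allVertices R blocks
      vertex∈ (v , x) with ram? v
      ... | yes rv = let m , eq = ram⇒just rv in R⊆allVertices blocks
        (R⁺ eq (subst (toℕ x <_) (trans (fibre-just n eq) (cong (p ^_) (m≤n⇒m⊓n≡m (bounded-n v eq)))) (toℕ<n x)))
      ... | no ¬r with vertexCover ¬r | lift-surjective (cast (fibre-nothing n (unram⇒nothing ¬r)) x)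
      ...   | i , sv | j , g , eq = allVertices⁺ (∈-map⁺ blockAt (∈-indices i g j))
        (subst (_∈ₗ inner (blockAt ((i , g) , j)))
          (cong (v ,_) (trans (red-unram _ ¬r) (trans (cong toℕ eq) (toℕ-cast _ x))))
          (∈-map⁺ (φ (toℕ (lift j g))) (J⁺ ¬r sv)))

      ∈vertex : ∀ {x} → x ∈ₗ allVertices R blocks → ∃[ u ] ι n u ≡ x
      ∈vertex {v , y} x∈ = (v , fromℕ< y<) , cong (v ,_) (toℕ-fromℕ< y<)
        where
        y< : y < fibre v n
        y< with allVertices⁻ blocks x∈
        ... | inj₁ x∈R = let m , eq , lt = R⁻ x∈R in
          subst (y <_) (trans (cong (p ^_) (sym (m≤n⇒m⊓n≡m (bounded-n v eq)))) (sym (fibre-just n eq))) lt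
        ... | inj₂ (B , B∈ , x∈B) with ∈-map⁻ blockAt B∈
        ...   | ((i , g) , j) , _ , refl with inner⁻ {i} x∈B
        ...     | ¬r , _ , refl = subst (_ <_) (sym (fibre-nothing n (unram⇒nothing ¬r))) (toℕ<n (lift j g))

      blocks-toWEdge : map toWEdge blocks ≡ concatMap (replicate (suc c)) quotientEdges
      blocks-toWEdge = trans (sym (map-∘ indices))
        (trans (map-cartesianProduct {h' = λ (i , g) → wedge (φ (toℕ g) (a i)) (φ (toℕ g) (b i)) (F i) (K i)}
            (cartesianProduct (allFin k) (allFin P)) (allFin (suc c)) at)
          (cong (λ l → concatMap (replicate l) quotientEdges) (length-tabulate {n = suc c} id)))
        where
        at : ∀ x j → toWEdge (blockAt (x , j)) ≡ wedge (φ (toℕ (proj₂ x)) (a (proj₁ x))) (φ (toℕ (proj₂ x)) (b (proj₁ x))) (F (proj₁ x)) (K (proj₁ x))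
        at (i , g) j = trans (block-toWEdge i (toℕ (lift j g)))
          (cong₂ (λ x y → wedge x y (F i) (K i)) (φ≡ (proj₂ (markedA i))) (φ≡ (proj₂ (markedB i))))
          where
          φ≡ : ∀ {v} → Ram v → φ (toℕ (lift j g)) v ≡ φ (toℕ g) v
          φ≡ {v} rv = cong (v ,_) (trans (cong (red v) (toℕ-lift j g)) (red-periodic rv (toℕ j) (toℕ g)))

      quotient-within : All (λ e → (WEdge.end₁ e , WEdge.end₂ e) Within R) quotientEdges
      quotient-within = Allₚ.map⁺ (All.universal
        (λ (i , g) → φ∈R (toℕ g) (proj₂ (markedA i)) , φ∈R (toℕ g) (proj₂ (markedB i))) _)

      numSpanningTrees-level : ∀ {κ x} → x ∈ₗ R → NumSpanningTrees (X n) κ →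
        κ ≡ suc c ^ (length R ∸ 1) * (product (map (λ f → f ^ (c * P)) (map F (allFin k))) * Z R [] quotientEdges)
      numSpanningTrees-level {κ} x∈ count = begin
        κ
          ≡⟨ GX.numSpanningTrees≡N count edgesX-unique edgesX-complete vertex∈ ∈vertex ⟩
        Count.N _≟W_ (allVertices R blocks) [] (map GX.ends edgesX)
          ≡⟨ cong (Count.N _≟W_ (allVertices R blocks) []) ends-edgesX ⟩
        Count.N _≟W_ (allVertices R blocks) [] (concatMap edges blocks)
          ≡⟨ N≡Z blocks-wf [] ⟩
        Z R [] (map toWEdge blocks)
          ≡⟨ cong (Z R []) blocks-toWEdge ⟩
        Z R [] (concatMap (replicate (suc c)) quotientEdges)
          -- Inserts `suc c ^ 0`, the credit of the empty initial state in `Z-multiply`.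
          ≡⟨ sym (*-identityʳ _) ⟩
        Z R [] (concatMap (replicate (suc c)) quotientEdges) * suc c ^ 0
          ≡⟨ Z-multiply R-unique x∈ c quotientEdges quotient-within tt [] ⟩
        suc c ^ (length R ∸ 1) * (product (map (λ e → WEdge.cut e ^ c) quotientEdges) * Z R [] quotientEdges)
          ≡⟨ cong (λ y → suc c ^ (length R ∸ 1) * (y * Z R [] quotientEdges)) (product-cuts c) ⟩
        suc c ^ (length R ∸ 1) * (product (map (λ f → f ^ (c * P)) (map F (allFin k))) * Z R [] quotientEdges) ∎
        where open ≡-Reasoning

-- From the segment decomposition to the formula.

module _ (p : ℕ) (pp : Prime p) (V E : ℕ) (s r : Fin E → Fin V) (I : Fin V → Maybe ℕ) where

  open TowerCount p pp V E s r I
  open Tower p pp V E s r I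
  open Marked G Ram

  segmentStructure : Connected G → (∃[ v ] (I v ≡ just 0)) → HasSegmentDecomposition →
    (segs : List (Subset E)) → Unique segs → (∀ S → (S ∈ₗ segs) ⇔ IsSegment S) →
    (F : Fin (length segs) → ℕ) → (∀ i → NumSegmentalForests (lookup segs i) (F i)) →
    SegmentStructure (length segs)
  segmentStructure conn (v₀ , ram₀) decomp segs uniq segs⇔ F forests = record
    { S = lookup segs ; F = F
    ; a = λ i → proj₁ (ends i)
    ; b = λ i → proj₁ (proj₂ (ends i))
    ; markedA = λ i → proj₁ (proj₂ (proj₂ (ends i)))
    ; markedB = λ i → proj₁ (proj₂ (proj₂ (proj₂ (ends i))))
    ; marked⇒ = λ i → proj₂ (proj₂ (proj₂ (proj₂ (ends i))))
    ; edgeCover = cover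
    ; edgeUnique = λ {_} {i} {j} e∈ e∈' → lookup-unique-injective uniq (segment-edge-unique (isSeg i) (isSeg j) e∈ e∈')
    ; vertexCover = vcover
    ; vertexUnique = λ {_} {i} {j} ¬r (_ , e∈ , inc) (_ , e'∈ , inc') → lookup-unique-injective uniq
        (segment-vertex-unique (isSeg i) (isSeg j) ¬r e∈ inc e'∈ inc')
    ; forests = forests }
    where
    open Segments G Fin._≟_ Ram ram?
    open Decomposition decomp
    isSeg : ∀ i → IsSegment (lookup segs i)
    isSeg i = to (segs⇔ _) (∈-lookup i)
    ends : ∀ i → ∃[ x ] ∃[ y ] (SegMarked (lookup segs i) x × SegMarked (lookup segs i) y
      × (∀ {m} → SegMarked (lookup segs i) m → m ≡ x ⊎ m ≡ y))
    ends i = segment-ends (isSeg i)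
    cover : ∀ e → ∃[ i ] e ∈ lookup segs i
    cover e = let S∋e = decidable-stable (Any.any? (e ∈?_) segs)
                          (λ k → segment-cover e λ (S , seg , e∈) → k (lose (from (segs⇔ S) seg) e∈))
              in Any.index S∋e , lookup-index S∋e
    vcover : ∀ {w} → Unram w → ∃[ i ] SegVertex (lookup segs i) w
    -- An unramified vertex differs from the totally ramified `v₀`, so a chain from it to `v₀`
    -- starts with an edge at that vertex.
    vcover {w} ¬r = go (proj₂ (conn w v₀))
      where
      go : ∀ {ds} → Chain G w ds v₀ → ∃[ i ] SegVertex (lookup segs i) w
      go nil with () ← trans (sym ram₀) (unram⇒nothing ¬r)
      go (cons d _ eq _) = let i , e∈ = cover (proj₁ d) in
        i , proj₁ d , e∈ , subst (Incident (proj₁ d)) eq (incident-o d)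

theorem5p18 :
  (p : ℕ) (pp : Prime p)
  (V E : ℕ) (s r : Fin E → Fin V) (I : Fin V → Maybe ℕ) →
  let G = baseGraph V E s r
      open Tower p pp V E s r I
      open Marked G Ram
  in Connected G →
     NoTails →
     (∀ n → Connected (X n)) →
     (∃[ v ] (I v ≡ just 0)) →
     HasSegmentDecomposition →
     (segs : List (Subset E)) →
     Unique segs →
     (∀ S → (S ∈ₗ segs) ⇔ IsSegment S) →
     (Fs : List ℕ) →
     Pointwise NumSegmentalForests segs Fs →
     (n₀ l : ℕ) →
     (∀ n → n₀ ≤ n → ramifiedCount n ≡ l) →
     (n : ℕ) → n₀ ≤ n →
     (κn κn₀ : ℕ) →
     NumSpanningTrees (X n) κn →
     NumSpanningTrees (X n₀) κn₀ →
     κn ≡ κn₀ * p ^ ((n ∸ n₀) * (l ∸ 1))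
            * product (map (λ F → F ^ (p ^ n ∸ p ^ n₀)) Fs)
theorem5p18 p pp V E s r I conn _ _ root@(v₀ , ram₀) decomp segs uniq segs⇔ Fs counts n₀ l stable n n₀≤n κn κn₀ treesₙ treesₙ₀
  with pointwise⇒tabulate counts
... | F , refl , forests = begin
  κn
    ≡⟨ Level.numSpanningTrees-level n c size n₀≤n root∈R treesₙ ⟩
  suc c ^ (length R ∸ 1) * (product (map (λ f → f ^ (c * P)) (map F (allFin k))) * z)
    ≡⟨ cong₂ (λ x y → x * (y * z)) powers products ⟩
  p ^ ((n ∸ n₀) * (l ∸ 1)) * (product (map (λ f → f ^ (p ^ n ∸ p ^ n₀)) (tabulate F)) * z)
    ≡⟨ solve 3 (λ x y z → x :* (y :* z) := z :* x :* y) refl (p ^ ((n ∸ n₀) * (l ∸ 1)))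
         (product (map (λ f → f ^ (p ^ n ∸ p ^ n₀)) (tabulate F))) z ⟩
  z * p ^ ((n ∸ n₀) * (l ∸ 1)) * product (map (λ f → f ^ (p ^ n ∸ p ^ n₀)) (tabulate F))
    ≡⟨ cong (λ x → x * p ^ ((n ∸ n₀) * (l ∸ 1)) * product (map (λ f → f ^ (p ^ n ∸ p ^ n₀)) (tabulate F))) (sym κn₀≡z) ⟩
  κn₀ * p ^ ((n ∸ n₀) * (l ∸ 1)) * product (map (λ f → f ^ (p ^ n ∸ p ^ n₀)) (tabulate F)) ∎
  where
  open ≡-Reasoning
  open TowerCount p pp V E s r I
  open Tower p pp V E s r I using (p≢0)
  bounded : Bounded n₀
  bounded = stable⇒bounded n₀ (trans (stable n₀ ≤-refl) (sym (stable (suc n₀) (n≤1+n n₀))))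
  k = length segs
  open WithSegments (segmentStructure p pp V E s r I conn root decomp segs uniq segs⇔ F forests) n₀ bounded
  -- One less than the size of a parallel class, so that the size is visibly a successor; `c * P` is
  -- then `p ^ n ∸ p ^ n₀`.
  c = pred (p ^ (n ∸ n₀))
  suc-c : suc c ≡ p ^ (n ∸ n₀)
  suc-c = suc-pred (p ^ (n ∸ n₀)) {{m^n≢0 p (n ∸ n₀)}}
  size : suc c * P ≡ p ^ n
  size = trans (cong (_* P) suc-c) (trans (sym (^-distribˡ-+-* p (n ∸ n₀) n₀)) (cong (p ^_) (m∸n+n≡m n₀≤n)))
  root∈R : (v₀ , 0) ∈ₗ R
  root∈R = R⁺ ram₀ (s≤s z≤n)
  z : ℕ
  z = Blocks.Z _≟W_ R [] quotientEdges
  powers : suc c ^ (length R ∸ 1) ≡ p ^ ((n ∸ n₀) * (l ∸ 1))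
  powers = trans (cong₂ (λ x y → x ^ (y ∸ 1)) suc-c (trans (length-R n₀ bounded) (stable n₀ ≤-refl)))
    (^-*-assoc p (n ∸ n₀) (l ∸ 1))
  products : product (map (λ f → f ^ (c * P)) (map F (allFin k)))
    ≡ product (map (λ f → f ^ (p ^ n ∸ p ^ n₀)) (tabulate F))
  products = cong₂ (λ e fs → product (map (λ f → f ^ e) fs))
    (trans (sym (m+n∸m≡n P (c * P))) (cong (_∸ P) size)) (map-tabulate id F)
  κn₀≡z : κn₀ ≡ z
  -- The level formula with `c = 0`, where both extra factors are 1, identifies the weighted sum `z`
  -- with the count at level `n₀`.
  κn₀≡z = begin
    κn₀
      ≡⟨ Level.numSpanningTrees-level n₀ 0 (+-identityʳ P) ≤-refl root∈R treesₙ₀ ⟩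
    1 ^ (length R ∸ 1) * (product (map (λ f → 1) (map F (allFin k))) * z)
      ≡⟨ cong₂ (λ x y → x * (y * z)) (^-zeroˡ (length R ∸ 1)) (ones (map F (allFin k))) ⟩
    1 * (1 * z)
      ≡⟨ trans (*-identityˡ _) (*-identityˡ z) ⟩
    z ∎
    where
    ones : ∀ (fs : List ℕ) → product (map (λ _ → 1) fs) ≡ 1
    ones []       = refl
    ones (_ ∷ fs) = trans (*-identityˡ _) (ones fs)
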